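{- Let $G$ be a connected graph of order $n$ and let $k \ge 3$ be an integer. Suppose that one of the following holds: (i) $k=3$, $n\ge 8$ and $\sigma_4(G)\ge 2n-7$; (ii) $k=4$, $n\ge 9$ and $\sigma_4(G)\ge n$; (iii) $k=5$, $n\ge 11$ and $\sigma_4(G)\ge n-1$; (iv) $k=6$, $n\ge 17$ and $\sigma_4(G)\ge \frac{n+5}{2}$; (v) $k\ge 7$, $\sigma_4(G)\ge \frac{4n-4k-7}{k+2}$, and moreover $n\ge 286$ if $k=7$, $n\ge 207$ if $k=8$, $n\ge 190$ if $k=9$, and $n> k^2+7k+18+\frac{33}{k-2}$ if $k\ge 10$. Then $cfc(G)\le k$.
   Context: All graphs are finite, without loops or multiple edges; the order of $G$ is $|V(G)|$, and $d_G(v)$ is the degree of $v$ in $G$. $\sigma_4(G)$ is the minimum of $\sum_{s\in S} d_G(s)$ over all independent sets $S\subseteq V(G)$ (no two vertices adjacent) with $|S|=4$; by convention $\sigma_4(G)=+\infty$ if $G$ has no independent set of size $4$. Given an edge-colouring of $G$ (not necessarily proper), a path is conflict-free if some colour appears on exactly one of its edges. An edge-coloured graph is conflict-free connected if every pair of distinct vertices is connected by a conflict-free path. The conflict-free connection number $cfc(G)$ of a connected graph $G$ is the minimum number of colours in an edge-colouring making $G$ conflict-free connected. -}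

module Defs where

open import Data.Bool using (Bool; T; T?)
open import Data.Fin using (Fin)
open import Data.Fin.Properties as Fin using (all?)
open import Data.Fin.Subset using (Subset; inside; outside; _∈_; ∣_∣)
open import Data.Fin.Subset.Properties using (_∈?_)
open import Data.Integer using (+_)
open import Data.List
  using (List; []; _∷_; [_]; map; _++_; filter; length; allFin)
open import Data.List.Extrema using (min)
open import Data.List.Relation.Unary.Unique.Propositional using (Unique)
open import Data.Maybe as Maybe using ()
open import Data.Nat as ℕ using (ℕ; zero; suc; NonZero; _∸_)
open import Data.Nat.Properties as ℕ using ()
open import Data.Nat.ListAction using (sum)
open import Data.Product using (Σ-syntax; ∃-syntax; _×_)
open import Data.Rational as ℚ using (ℚ)
open import Data.Vec as Vec using (tabulate)
open import Level using (0ℓ)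
open import Relation.Binary using (Rel; TotalOrder)
open import Relation.Binary.Construct.Closure.ReflexiveTransitive
  using (Star; ε; _◅_)
open import Relation.Binary.PropositionalEquality using (_≡_; _≢_)
open import Relation.Nullary using (¬_; Dec)
open import Relation.Nullary.Decidable using (¬?; _×-dec_; _→-dec_)
open import Relation.Nullary.Construct.Add.Supremum as Sup using (_⁺; ⊤⁺)
import Relation.Binary.Construct.Add.Supremum.NonStrict as SupOrder

record Graph (n : ℕ) : Set where
  field
    adj       : Fin n → Fin n → Bool
    symmetric : ∀ u v → adj u v ≡ adj v u
    loopless  : ∀ v → ¬ T (adj v v)

  Adj : Rel (Fin n) 0ℓ
  Adj u v = T (adj u v)

  degree : Fin n → ℕ
  degree v = ∣ tabulate (adj v) ∣

  Independent : Subset n → Set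
  Independent S = ∀ u v → u ∈ S → v ∈ S → ¬ Adj u v

  independent? : ∀ S → Dec (Independent S)
  independent? S = all? λ u → all? λ v →
    (u ∈? S) →-dec ((v ∈? S) →-dec ¬? (T? (adj u v)))

  Walk : Rel (Fin n) 0ℓ
  Walk = Star Adj

  Connected : Set
  Connected = ∀ u v → Walk u v

  vertices : ∀ {u v} → Walk u v → List (Fin n)
  vertices {u} ε       = [ u ]
  vertices {u} (_ ◅ w) = u ∷ vertices w

  IsPath : ∀ {u v} → Walk u v → Set
  IsPath w = Unique (vertices w)

open Graph public

-- The natural numbers extended by +∞, written ⊤⁺.
ℕ∞-totalOrder : TotalOrder 0ℓ 0ℓ 0ℓ
ℕ∞-totalOrder = record
  { isTotalOrder = SupOrder.≤⁺-isTotalOrder-≡ ℕ._≤_ ℕ.≤-isTotalOrder }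

infix 4 _≥∞_

_≥∞_ : ℕ ⁺ → ℚ → Set
x ≥∞ q = Sup.[ q ] ≤⁺ Maybe.map (λ m → + m ℚ./ 1) x
  where open SupOrder ℚ._≤_ using (_≤⁺_)

allSubsets : ∀ n → List (Subset n)
allSubsets zero    = [ Vec.[] ]
allSubsets (suc n) =
  map (inside Vec.∷_) (allSubsets n) ++ map (outside Vec.∷_) (allSubsets n)

degreeSum : ∀ {n} → Graph n → Subset n → ℕ
degreeSum {n} G S = sum (map (degree G) (filter (_∈? S) (allFin n)))

-- The minimum over the empty list is ⊤⁺.
σ₄ : ∀ {n} → Graph n → ℕ ⁺
σ₄ {n} G = min ℕ∞-totalOrder ⊤⁺
  (map (λ S → Sup.[ degreeSum G S ])
    (filter (λ S → independent? G S ×-dec (∣ S ∣ ℕ.≟ 4)) (allSubsets n)))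

-- Adj u v is proof-irrelevant, so an edge receives a single colour; the law
-- `undirected` makes it independent of the orientation.
record EdgeColouring {n} (G : Graph n) (c : ℕ) : Set where
  field
    colour     : ∀ {u v} → Adj G u v → Fin c
    undirected : ∀ {u v} (e : Adj G u v) (e′ : Adj G v u) →
                 colour e ≡ colour e′

  colours : ∀ {u v} → Walk G u v → List (Fin c)
  colours ε       = []
  colours (e ◅ w) = colour e ∷ colours w

  ConflictFree : ∀ {u v} → Walk G u v → Set
  ConflictFree w = ∃[ x ] length (filter (x Fin.≟_) (colours w)) ≡ 1

  ConflictFreeConnected : Set
  ConflictFreeConnected = ∀ u v → u ≢ v →
    Σ[ p ∈ Walk G u v ] IsPath G p × ConflictFree p

open EdgeColouring public

ConflictFreeColourable : ∀ {n} → Graph n → ℕ → Set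
ConflictFreeColourable G c = Σ[ f ∈ EdgeColouring G c ] ConflictFreeConnected f

IsLeast : (ℕ → Set) → ℕ → Set
IsLeast P m = P m × (∀ j → P j → m ℕ.≤ j)

-- cfc(G) = c, stated as a relation.
IsCfc : ∀ {n} → Graph n → ℕ → Set
IsCfc G = IsLeast (ConflictFreeColourable G)

3≤k⇒k∸2≢0 : ∀ {k} → 3 ℕ.≤ k → NonZero (k ∸ 2)
3≤k⇒k∸2≢0 3≤k = ℕ.>-nonZero (ℕ.m<n⇒0<n∸m 3≤k)

-- k² + 7k + 18 + 33/(k − 2); the truncated subtraction is exact since 3 ≤ k.
orderBound : ∀ k → 3 ℕ.≤ k → ℚ
orderBound k 3≤k =
  (+ (k ℕ.^ 2 ℕ.+ 7 ℕ.* k ℕ.+ 18) ℚ./ 1)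
    ℚ.+ ((+ 33) ℚ./ (k ∸ 2)) ⦃ 3≤k⇒k∸2≢0 3≤k ⦄

{-# OPTIONS --safe #-}

-- Let T be a spanning tree of G.  Give the edges off T one colour and the edges of T that
-- are not bridges another.  If the path of T from u to v contains a non-bridge z, then
-- exchanging z for an edge off T across the cut of T − z gives a walk with exactly one edge
-- off T, so only the bridges of G need care.  Let M be a matching of bridges; colour M with
-- one colour and the other bridges with distinct ones.  A path of two or more bridges meets
-- a bridge outside M, whose colour is unique, so b − |M| + 1 colours suffice for b bridges.
--
-- A greedy maximum matching of the tree of 2-edge-connected components leaves unmatched a
-- set I of pairwise nonadjacent components with |I| = b − |M| + 1.  Their topmost vertices
-- are independent and have degree sum less than n, which contradicts the bound on σ₄ for
-- k ≤ 5 if |I| > k.  For k ≥ 6 call a component good if some vertex of it is on no bridge.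
-- These vertices have disjoint closed neighbourhoods, whereas every vertex of a bad
-- component has degree at most the number g of good components, because each bridge leaving
-- its component leads to a good one.  Four vertices chosen from nonadjacent bad components
-- and from the good components where the degrees are smallest then contradict the bound.

module Submission where

open import Defs
open import Data.Bool using (Bool; true; false; T; T?)
import Data.Bool.Properties as Bool
open import Data.Empty using (⊥; ⊥-elim)
open import Data.Fin as Fin using (Fin; zero; suc; toℕ)
open import Data.Fin.Properties as Fin using (_≟_; any?; all?)
open import Data.Fin.Subset as Subset using (Subset)
import Data.Fin.Subset.Properties as Subset
open import Data.Integer as ℤ using ()
import Data.Integer.Properties as ℤ
open import Data.List
  using (List; []; _∷_; [_]; map; _++_; filter; length; allFin; concatMap; lookup; tabulate)
open import Data.List.Properties
  using (length-map; length-++; length-tabulate; ++-identityʳ; map-++; map-∘; map-cong;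
         filter-++; filter-none; filter-accept)
open import Data.List.Extrema ℕ∞-totalOrder using (f[argmin]≤f[xs])
open import Data.List.Membership.Propositional using (_∈_; _∉_; lose; find)
open import Data.List.Membership.Propositional.Properties
open import Data.List.Relation.Binary.Subset.Propositional using (_⊆_)
open import Data.List.Relation.Binary.Permutation.Propositional
  using (_↭_; ↭-refl; ↭-sym; ↭-trans; prep; ↭-reflexive; ↭⇒↭ₛ)
import Data.List.Relation.Binary.Permutation.Propositional.Properties as Perm
import Data.List.Relation.Binary.Permutation.Setoid.Properties as SetoidPerm
open import Data.List.Relation.Binary.BagAndSetEquality using (∼bag⇒↭)
open import Data.List.Membership.Propositional.Properties.WithK using (unique∧set⇒bag)
open import Data.List.Relation.Unary.All as All using ([]; _∷_)
import Data.List.Relation.Unary.All.Properties as All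
open import Data.List.Relation.Unary.AllPairs as AllPairs using ([]; _∷_)
open import Data.List.Relation.Unary.Any as Any using (Any; here; there)
import Data.List.Relation.Unary.Any.Properties as Any
open import Data.List.Relation.Unary.Unique.Propositional using (Unique)
import Data.List.Relation.Unary.Unique.Propositional.Properties as Unique
import Data.List.Membership.DecPropositional as DecMembership
open import Data.Nat as ℕ using (ℕ; zero; suc; _+_; _*_; _∸_; _≤_; _<_; _≥_; z≤n; s≤s)
open import Data.Nat.ListAction using (sum)
open import Data.Nat.ListAction.Properties using (sum-++; sum-↭)
open import Data.Nat.Properties as ℕ using (≤-trans; ≤-refl; ≤-reflexive; n≮n; module ≤-Reasoning)
open import Data.Nat.Tactic.RingSolver using (solve-∀)
open import Data.Product using (Σ; Σ-syntax; ∃; ∃-syntax; _×_; _,_; proj₁; proj₂)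
open import Data.Rational as ℚ using (ℚ; _/_)
import Data.Rational.Properties as ℚ
import Data.Rational.Unnormalised as ℚᵘ
import Data.Rational.Unnormalised.Properties as ℚᵘ
open import Data.Sum using (_⊎_; inj₁; inj₂; [_,_]′)
open import Data.Unit using (⊤; tt)
open import Data.Vec as Vec using (Vec)
import Data.Vec.Properties as Vec
open import Function using (_∘_; id; mk⇔; Equivalence; case_of_)
open import Relation.Binary.Construct.Closure.ReflexiveTransitive using (ε; _◅_; _◅◅_)
open import Relation.Binary.PropositionalEquality
  using (_≡_; _≢_; refl; sym; trans; cong; cong₂; subst; subst₂; setoid;
         module ≡-Reasoning)
open import Relation.Nullary using (¬_; Dec; yes; no)
open import Relation.Nullary.Decidable 
  using (¬?; _×-dec_; _⊎-dec_; _→-dec_; ⌊_⌋; toWitness; fromWitness; map′; decidable-stable)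
import Relation.Nullary.Construct.Add.Supremum as Sup
import Relation.Binary.Construct.Add.Supremum.NonStrict as SupOrder
open import Relation.Unary using (Decidable)

-- Lists

-- The obstacle for k ≥ 6 is a shortfall of one. Four interior vertices only show that there are at
-- most k + 1 good components: the bound (4n - 4k - 7)/(k + 2) just fails for k + 2 disjoint closed
-- neighbourhoods. The last unit comes from the matching. A matched component is either good, and
-- then I misses it, or bad, and then it supplies a vertex of small degree. Excluding k + 1 good
-- components beside one such vertex comes down to n > k² + 7k + 18 + 33/(k - 2), which is the order
-- bound of (v). That bad components have small degrees presupposes minimum degree 2, since
-- otherwise a bridge may lead to a mere leaf. In (v) a leaf is excluded by averaging over k other
-- members of I, which works because 3/k < 4/(k + 2). At k = 6 the two fractions agree. There the
-- summand 5 in (n + 5)/2 takes over: it forces degree at least 6 on all of I.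

Unique-⊆-length : ∀ {A : Set} {xs ys : List A} → Unique xs → xs ⊆ ys → length xs ≤ length ys
Unique-⊆-length {xs = []} _ _ = z≤n
Unique-⊆-length {xs = x ∷ xs} (x∉xs ∷ u) xs⊆ys with ∈-∃++ (xs⊆ys (here refl))
... | ys₁ , ys₂ , refl =
  ≤-trans (s≤s (Unique-⊆-length u sub)) (≤-reflexive (sym (Perm.↭-length (Perm.shift x ys₁ ys₂))))
  where
  sub : xs ⊆ ys₁ ++ ys₂
  sub z∈xs with Perm.∈-resp-↭ (Perm.shift x ys₁ ys₂) (xs⊆ys (there z∈xs))
  ... | here refl = ⊥-elim (All.lookup x∉xs z∈xs refl)
  ... | there z∈  = z∈

Unique-map : ∀ {A B : Set} (f : A → B) {xs} → Unique xs →
             (∀ {x y} → x ∈ xs → y ∈ xs → f x ≡ f y → x ≡ y) → Unique (map f xs)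
Unique-map f [] inj = []
Unique-map f {x ∷ xs} (x∉xs ∷ u) inj =
  All.map⁺ (All.tabulate λ y∈xs eq → All.lookup x∉xs y∈xs (inj (here refl) (there y∈xs) eq))
  ∷ Unique-map f u (λ p q → inj (there p) (there q))

Unique-concatMap : ∀ {A B : Set} (f : A → List B) {xs} → Unique xs →
                   (∀ {x} → x ∈ xs → Unique (f x)) →
                   (∀ {x y z} → x ∈ xs → y ∈ xs → z ∈ f x → z ∈ f y → x ≡ y) →
                   Unique (concatMap f xs)
Unique-concatMap f [] uf disj = []
Unique-concatMap f {x ∷ xs} (x∉xs ∷ u) uf disj =
  Unique.++⁺ (uf (here refl))
    (Unique-concatMap f u (uf ∘ there) (λ p q → disj (there p) (there q)))
    λ (z∈fx , z∈rest) → let y , y∈xs , z∈fy = find (∈-concatMap⁻ f z∈rest) in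
      All.lookup x∉xs y∈xs (disj (here refl) (there y∈xs) z∈fx z∈fy)

length-concatMap : ∀ {A B : Set} (f : A → List B) xs → length (concatMap f xs) ≡ sum (map (length ∘ f) xs)
length-concatMap f []       = refl
length-concatMap f (x ∷ xs) = trans (length-++ (f x)) (cong (length (f x) +_) (length-concatMap f xs))

module _ {A : Set} where
  Unique-resp-↭ : {xs ys : List A} → xs ↭ ys → Unique xs → Unique ys
  Unique-resp-↭ p = SetoidPerm.Unique-resp-↭ (setoid A) (↭⇒↭ₛ p)

  ∈⇒↭ : ∀ {x : A} {xs} → x ∈ xs → ∃[ ys ] xs ↭ x ∷ ys
  ∈⇒↭ {x} x∈xs with ∈-∃++ x∈xs
  ... | ys , zs , refl = ys ++ zs , Perm.shift x ys zs

module _ {A : Set} (w : A → ℕ) where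

  weight : List A → ℕ
  weight = sum ∘ map w

  weight-↭ : ∀ {xs ys} → xs ↭ ys → weight xs ≡ weight ys
  weight-↭ p = sum-↭ (Perm.map⁺ w p)

  weight-++ : ∀ xs ys → weight (xs ++ ys) ≡ weight xs + weight ys
  weight-++ xs ys = trans (cong sum (map-++ w xs ys)) (sum-++ (map w xs) (map w ys))

  weight-bound : ∀ {m} xs → (∀ {x} → x ∈ xs → w x ≤ m) → weight xs ≤ length xs * m
  weight-bound []       _ = z≤n
  weight-bound (x ∷ xs) h = ℕ.+-mono-≤ (h (here refl)) (weight-bound xs (h ∘ there))

  maximum : ∀ x xs → ∃[ m ] ∃[ ys ] x ∷ xs ↭ m ∷ ys × (∀ {y} → y ∈ m ∷ ys → w y ≤ w m)
  maximum x [] = x , [] , ↭-refl , λ { (here refl) → ≤-refl }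
  maximum x (x′ ∷ xs) with maximum x′ xs
  ... | m , ys , p , h with ℕ.≤-total (w x) (w m)
  ... | inj₁ wx≤wm = m , x ∷ ys , ↭-trans (prep x p) (Perm.shift m [ x ] ys) ,
                     λ { (here refl) → ≤-refl ; (there (here refl)) → wx≤wm ; (there (there y∈)) → h (there y∈) }
  ... | inj₂ wm≤wx = x , m ∷ ys , prep x p ,
                     λ { (here refl) → ≤-refl ; (there y∈) → ≤-trans (h y∈) wm≤wx }

  -- Discarding a heaviest element repeatedly leaves t elements of at most average weight.
  lightest : ∀ t xs → t ≤ length xs →
             ∃[ ys ] ∃[ zs ] xs ↭ ys ++ zs × length ys ≡ t × length xs * weight ys ≤ t * weight xs
  lightest t xs t≤ = go (length xs) xs refl t≤
    where
    go : ∀ l xs → length xs ≡ l → t ≤ l →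
         ∃[ ys ] ∃[ zs ] xs ↭ ys ++ zs × length ys ≡ t × length xs * weight ys ≤ t * weight xs
    go l xs eq t≤l with t ℕ.≟ l
    ... | yes refl = xs , [] , ↭-reflexive (sym (++-identityʳ xs)) , eq , ≤-reflexive (cong (_* weight xs) eq)
    go zero xs eq t≤l | no t≢l = ⊥-elim (t≢l (ℕ.n≤0⇒n≡0 t≤l))
    go (suc l) (x ∷ xs) eq t≤l | no t≢l with maximum x xs
    ... | m , ys , p , h with go l ys (ℕ.suc-injective (trans (sym (Perm.↭-length p)) eq))
                                 (ℕ.≤-pred (ℕ.≤∧≢⇒< t≤l t≢l))
    ... | as , bs , q , refl , avg = as , m ∷ bs ,
          ↭-trans p (↭-trans (prep m q) (↭-sym (Perm.shift m as bs))) , refl , bound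
      where
      open ≤-Reasoning
      bound : length (x ∷ xs) * weight as ≤ length as * weight (x ∷ xs)
      bound = begin
        length (x ∷ xs) * weight as               ≡⟨ cong (_* weight as) (Perm.↭-length p) ⟩
        weight as + length ys * weight as         ≤⟨ ℕ.+-mono-≤
          (weight-bound as λ a∈ → h (there (Perm.∈-resp-↭ (↭-sym q) (∈-++⁺ˡ a∈)))) avg ⟩
        length as * w m + length as * weight ys   ≡⟨ ℕ.*-distribˡ-+ (length as) (w m) (weight ys) ⟨
        length as * weight (m ∷ ys)               ≡⟨ cong (length as *_) (weight-↭ p) ⟨
        length as * weight (x ∷ xs)               ∎

-- Rational inequalities and the meaning of σ₄

fromℚᵘ-mono-≤ : ∀ {p q} → p ℚᵘ.≤ q → ℚ.fromℚᵘ p ℚ.≤ ℚ.fromℚᵘ q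
fromℚᵘ-mono-≤ {p} {q} p≤q = ℚ.toℚᵘ-cancel-≤
  (ℚᵘ.≤-respˡ-≃ (ℚᵘ.≃-sym (ℚ.toℚᵘ-fromℚᵘ p)) (ℚᵘ.≤-respʳ-≃ (ℚᵘ.≃-sym (ℚ.toℚᵘ-fromℚᵘ q)) p≤q))

-- `_/_` reduces to lowest terms, but `i / suc d` is by definition `fromℚᵘ` of the unreduced
-- fraction. Inequalities are therefore moved to unreduced fractions, where they are
-- cross-multiplications.
fromℚᵘ-cancel-≤ : ∀ {p q} → ℚ.fromℚᵘ p ℚ.≤ ℚ.fromℚᵘ q → p ℚᵘ.≤ q
fromℚᵘ-cancel-≤ {p} {q} p≤q =
  ℚᵘ.≤-respˡ-≃ (ℚ.toℚᵘ-fromℚᵘ p) (ℚᵘ.≤-respʳ-≃ (ℚ.toℚᵘ-fromℚᵘ q) (ℚ.toℚᵘ-mono-≤ p≤q))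

∣tabulate∣ : ∀ {n m} (f : Fin n → Bool) (g : Fin m → Fin n) →
             Subset.∣ Vec.tabulate (f ∘ g) ∣ ≡ length (filter (T? ∘ f) (tabulate g))
∣tabulate∣ {m = zero}  f g = refl
∣tabulate∣ {m = suc m} f g with f (g zero)
... | true  = cong suc (∣tabulate∣ f (g ∘ suc))
... | false = ∣tabulate∣ f (g ∘ suc)

∈allSubsets : ∀ {n} (S : Subset n) → S ∈ allSubsets n
∈allSubsets Vec.[]            = here refl
∈allSubsets (true  Vec.∷ S) = ∈-++⁺ˡ (∈-map⁺ _ (∈allSubsets S))
∈allSubsets (false Vec.∷ S) = ∈-++⁺ʳ _ (∈-map⁺ _ (∈allSubsets S))

module _ {n} (G : Graph n) where

  neighbours : Fin n → List (Fin n)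
  neighbours v = filter (T? ∘ adj G v) (allFin n)

  ∈-neighbours⁺ : ∀ {v w} → Adj G v w → w ∈ neighbours v
  ∈-neighbours⁺ = ∈-filter⁺ (T? ∘ adj G _) (∈-allFin _)

  ∈-neighbours⁻ : ∀ {v w} → w ∈ neighbours v → Adj G v w
  ∈-neighbours⁻ {v} w∈ = proj₂ (∈-filter⁻ (T? ∘ adj G v) {xs = allFin n} w∈)

  neighbours-unique : ∀ v → Unique (neighbours v)
  neighbours-unique v = Unique.filter⁺ (T? ∘ adj G v) (Unique.allFin⁺ n)

  degree≡length : ∀ v → degree G v ≡ length (neighbours v)
  degree≡length v = ∣tabulate∣ (adj G v) id

  Adj-sym : ∀ {u v} → Adj G u v → Adj G v u
  Adj-sym {u} {v} = subst T (symmetric G u v)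

  IndependentList : List (Fin n) → Set
  IndependentList xs = ∀ {x y} → x ∈ xs → y ∈ xs → ¬ Adj G x y

  totalDegree : List (Fin n) → ℕ
  totalDegree = weight (degree G)

  -- The interface to `σ₄`: independent sets are handled as duplicate-free lists everywhere else,
  -- and only here is such a list turned into its characteristic vector.
  σ₄-lower-bound : ∀ {q} → σ₄ G ≥∞ q → ∀ xs → Unique xs → length xs ≡ 4 → IndependentList xs →
                   q ℚ.≤ (ℤ.+ totalDegree xs) / 1
  σ₄-lower-bound {q} bound xs u len ind = SupOrder.[≤]-injective ℚ._≤_ (lower (σ₄ G) σ₄≤ bound)
    where
    open SupOrder ℕ._≤_ using (_≤⁺_; [_]; _≤⊤⁺)
    module ∈ᵈ = DecMembership (Fin._≟_ {n})
    S : Subset n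
    S = Vec.tabulate (λ v → ⌊ v ∈ᵈ.∈? xs ⌋)
    ∈S⇒∈xs : ∀ {v} → v Subset.∈ S → v ∈ xs
    ∈S⇒∈xs {v} v∈S = toWitness (subst T (sym (trans (sym (Vec.lookup∘tabulate _ v)) (Vec.[]=⇒lookup v∈S))) tt)
    ∈xs⇒∈S : ∀ {v} → v ∈ xs → v Subset.∈ S
    ∈xs⇒∈S {v} v∈xs = Vec.lookup⇒[]= v S (trans (Vec.lookup∘tabulate _ v)
      (Equivalence.to Bool.T-≡ (fromWitness {a? = v ∈ᵈ.∈? xs} v∈xs)))
    listing : ∀ {P : Fin n → Set} (P? : Decidable P) → (∀ {v} → P v → v ∈ xs) → (∀ {v} → v ∈ xs → P v) →
              filter P? (allFin n) ↭ xs
    listing P? f g = ∼bag⇒↭ (unique∧set⇒bag (Unique.filter⁺ P? (Unique.allFin⁺ n)) u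
      (mk⇔ (f ∘ proj₂ ∘ ∈-filter⁻ P? {xs = allFin n}) (∈-filter⁺ P? (∈-allFin _) ∘ g)))
    ∣S∣≡4 : Subset.∣ S ∣ ≡ 4
    ∣S∣≡4 = trans (∣tabulate∣ (λ v → ⌊ v ∈ᵈ.∈? xs ⌋) id)
      (trans (Perm.↭-length (listing _ toWitness fromWitness)) len)
    degreeSum≡ : degreeSum G S ≡ totalDegree xs
    degreeSum≡ = weight-↭ (degree G) (listing (Subset._∈? S) ∈S⇒∈xs ∈xs⇒∈S)
    good? = λ S′ → independent? G S′ ×-dec (Subset.∣ S′ ∣ ℕ.≟ 4)
    σ₄≤ : σ₄ G ≤⁺ Sup.[ totalDegree xs ]
    σ₄≤ = subst (λ d → σ₄ G ≤⁺ Sup.[ d ]) degreeSum≡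
      (All.lookup (f[argmin]≤f[xs] {f = id} Sup.⊤⁺ _)
        (∈-map⁺ (λ S′ → Sup.[ degreeSum G S′ ]) (∈-filter⁺ good? (∈allSubsets S)
          ((λ u v u∈ v∈ → ind (∈S⇒∈xs u∈) (∈S⇒∈xs v∈)) , ∣S∣≡4))))
    lower : ∀ s {d} → s ≤⁺ Sup.[ d ] → s ≥∞ q → Sup.[ d ] ≥∞ q
    lower Sup.[ c ] {d} SupOrder.[ c≤d ] SupOrder.[ q≤c ] =
      SupOrder.[ ℚ.≤-trans q≤c (fromℚᵘ-mono-≤ {ℚᵘ.mkℚᵘ (ℤ.+ c) 0} {ℚᵘ.mkℚᵘ (ℤ.+ d) 0}
        (ℚᵘ.*≤* (ℤ.*-monoʳ-≤-nonNeg (ℤ.+ 1) (ℤ.+≤+ c≤d)))) ]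

-- Spanning trees, bridges and 2-edge-connected components

least : ∀ {P : ℕ → Set} → Decidable P → ∀ b → P b → ∃[ m ] P m × (∀ j → P j → m ≤ j)
least P? zero    p = zero , p , λ _ _ → z≤n
least P? (suc b) p with P? zero
... | yes p₀ = zero , p₀ , λ _ _ → z≤n
... | no ¬p₀ with least (P? ∘ suc) b p
... | m , pm , min = suc m , pm , λ { zero q → ⊥-elim (¬p₀ q) ; (suc j) q → s≤s (min j q) }

Fin-bounded : ∀ {n} (f : Fin n → ℕ) → ∃[ b ] ∀ v → f v ≤ b
Fin-bounded {n} f = sum (map f (allFin n)) , λ v → go (∈-allFin v)
  where
  go : ∀ {v xs} → v ∈ xs → f v ≤ sum (map f xs)
  go (here refl) = ℕ.m≤m+n _ _
  go (there v∈)  = ≤-trans (go v∈) (ℕ.m≤n+m _ _)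

record SpanningTree {n} (G : Graph n) (r : Fin n) : Set where
  field
    depth : Fin n → ℕ
    p     : Fin n → Fin n
    p-adj : ∀ {v} → v ≢ r → Adj G v (p v)
    p<    : ∀ {v} → v ≢ r → depth (p v) < depth v
    p-r   : p r ≡ r

module _ {n} (G : Graph n) (connected : Connected G) (r : Fin n) where

  private
    Reach : ℕ → Fin n → Set
    Reach zero    v = v ≡ r
    Reach (suc m) v = ∃[ w ] Adj G v w × Reach m w

    reach? : ∀ m → Decidable (Reach m)
    reach? zero    v = v ≟ r
    reach? (suc m) v = any? λ w → T? _ ×-dec reach? m w

    walk⇒reach : ∀ {v} → Walk G v r → ∃[ m ] Reach m v
    walk⇒reach ε       = 0 , refl
    walk⇒reach (e ◅ w) = let m , x = walk⇒reach w in suc m , _ , e , x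

    distance : ∀ v → ∃[ m ] Reach m v × (∀ j → Reach j v → m ≤ j)
    distance v = let m , x = walk⇒reach (connected v r) in least (λ j → reach? j v) m x

    step : ∀ v → Σ[ w ∈ Fin n ] (v ≢ r → Adj G v w × proj₁ (distance w) < proj₁ (distance v)) × (v ≡ r → w ≡ r)
    step v with v ≟ r
    ... | yes v≡r = r , (λ v≢r → ⊥-elim (v≢r v≡r)) , λ _ → refl
    ... | no v≢r with distance v
    ... | zero  , v≡r , _ = ⊥-elim (v≢r v≡r)
    ... | suc m , (w , e , x) , _ = w , (λ _ → e , s≤s (proj₂ (proj₂ (distance w)) m x)) , λ v≡r → ⊥-elim (v≢r v≡r)

  bfs-tree : SpanningTree G r
  bfs-tree = record
    { depth = proj₁ ∘ distance
    ; p     = proj₁ ∘ step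
    ; p-adj = λ v≢r → proj₁ (proj₁ (proj₂ (step _)) v≢r)
    ; p<    = λ v≢r → proj₂ (proj₁ (proj₂ (step _)) v≢r)
    ; p-r   = proj₂ (proj₂ (step r)) refl
    }

-- The kernel of a well-founded digraph: with E c x read as a move from c to x,
-- the positions from which the player to move wins.
module _ {n} {E : Fin n → Fin n → Set} (E? : ∀ c x → Dec (E c x))
         (rank : Fin n → ℕ) (rank< : ∀ {c x} → E c x → rank c < rank x) where

  private
    Wins : ℕ → Fin n → Set
    Wins zero    c = ⊥
    Wins (suc m) c = ∃[ x ] E c x × ¬ Wins m x

    wins? : ∀ m → Decidable (Wins m)
    wins? zero    c = no λ ()
    wins? (suc m) c = any? λ x → E? c x ×-dec ¬? (wins? m x)

    bound = proj₁ (Fin-bounded rank)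

    -- Moves raise the rank, so a play from c lasts at most bound - rank c moves, and once more than
    -- that are allowed a further one changes nothing. At `suc bound` the counter thus disappears
    -- from the recursive description of winning.
    stable : ∀ m {c} → bound < rank c + m → (Wins m c → Wins (suc m) c) × (Wins (suc m) c → Wins m c)
    stable zero {c} b< = ⊥-elim (n≮n bound
      (ℕ.<-≤-trans b< (≤-trans (≤-reflexive (ℕ.+-identityʳ _)) (proj₂ (Fin-bounded rank) c))))
    stable (suc m) {c} b< =
      (λ (x , e , ¬w) → x , e , ¬w ∘ proj₂ (next e)) , (λ (x , e , ¬w) → x , e , ¬w ∘ proj₁ (next e))
      where
      next : ∀ {x} → E c x → (Wins m x → Wins (suc m) x) × (Wins (suc m) x → Wins m x)
      next {x} e = stable m (ℕ.<-≤-trans b<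
        (≤-trans (≤-reflexive (ℕ.+-suc (rank c) m)) (ℕ.+-monoˡ-≤ m (rank< e))))

  abstract
    Winning : Fin n → Set
    Winning = Wins (suc bound)

    winning? : Decidable Winning
    winning? = wins? (suc bound)

    winning⁻ : ∀ {c} → Winning c → ∃[ x ] E c x × ¬ Winning x
    winning⁻ {c} = proj₁ (stable (suc bound) (ℕ.m≤n+m (suc bound) (rank c)))

    winning⁺ : ∀ {c x} → E c x → ¬ Winning x → Winning c
    winning⁺ {c} e ¬w = proj₂ (stable (suc bound) (ℕ.m≤n+m (suc bound) (rank c))) (_ , e , ¬w)

module Rooted {n} {G : Graph n} {r : Fin n} (tree : SpanningTree G r) where
  open SpanningTree tree public

  tree-induction : (P : Fin n → Set) → P r → (∀ {v} → v ≢ r → P (p v) → P v) → ∀ v → P v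
  tree-induction P Pr Pv v = go (depth v) v ≤-refl
    where
    go : ∀ d v → depth v ≤ d → P v
    go d v dv≤d with v ≟ r
    ... | yes refl = Pr
    go zero    v dv≤d | no v≢r = ⊥-elim (ℕ.n≮0 (ℕ.<-≤-trans (p< v≢r) dv≤d))
    go (suc d) v dv≤d | no v≢r = Pv v≢r (go d (p v) (ℕ.≤-pred (ℕ.<-≤-trans (p< v≢r) dv≤d)))

  infix 4 _⊑_ _⊑?_

  data _⊑_ : Fin n → Fin n → Set where
    here : ∀ {x} → x ⊑ x
    up   : ∀ {w x} → w ≢ r → p w ⊑ x → w ⊑ x

  ⊑-split : ∀ {w x} → w ⊑ x → w ≢ x → w ≢ r × p w ⊑ x
  ⊑-split here     w≢x = ⊥-elim (w≢x refl)
  ⊑-split (up a b) w≢x = a , b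

  ⊑-trans : ∀ {x y z} → x ⊑ y → y ⊑ z → x ⊑ z
  ⊑-trans here     q = q
  ⊑-trans (up a b) q = up a (⊑-trans b q)

  ⊑-depth : ∀ {x y} → x ⊑ y → depth y ≤ depth x
  ⊑-depth here     = ≤-refl
  ⊑-depth (up a b) = ≤-trans (⊑-depth b) (ℕ.<⇒≤ (p< a))

  ⊑-depth-≡ : ∀ {x y} → x ⊑ y → depth x ≤ depth y → x ≡ y
  ⊑-depth-≡ here     _  = refl
  ⊑-depth-≡ (up a b) x≤ = ⊥-elim (n≮n _ (ℕ.<-≤-trans (p< a) (≤-trans x≤ (⊑-depth b))))

  ⊑-antisym : ∀ {x y} → x ⊑ y → y ⊑ x → x ≡ y
  ⊑-antisym x⊑y y⊑x = ⊑-depth-≡ x⊑y (⊑-depth y⊑x)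

  ⊑-r : ∀ v → v ⊑ r
  ⊑-r = tree-induction (_⊑ r) here up

  r⊑⇒≡ : ∀ {x} → r ⊑ x → x ≡ r
  r⊑⇒≡ here     = refl
  r⊑⇒≡ (up a _) = ⊥-elim (a refl)

  abstract
    _⊑?_ : ∀ w x → Dec (w ⊑ x)
    w ⊑? x = tree-induction (λ w → Dec (w ⊑ x)) root step w
      where
      root : Dec (r ⊑ x)
      root with r ≟ x
      ... | yes refl = yes here
      ... | no r≢x = no λ q → r≢x (sym (r⊑⇒≡ q))
      step : ∀ {w} → w ≢ r → Dec (p w ⊑ x) → Dec (w ⊑ x)
      step {w} w≢r d with w ≟ x | d
      ... | yes refl | _     = yes here
      ... | no w≢x   | yes q = yes (up w≢r q)
      ... | no w≢x   | no ¬q = no λ q → ¬q (proj₂ (⊑-split q w≢x))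

  ⊑-laminar : ∀ {w x y} → w ⊑ x → w ⊑ y → x ⊑ y ⊎ y ⊑ x
  ⊑-laminar here     q        = inj₁ q
  ⊑-laminar (up a b) here     = inj₂ (up a b)
  ⊑-laminar (up a b) (up c d) = ⊑-laminar b d

  below : Fin n → Fin n → Bool
  below z w = ⌊ w ⊑? z ⌋

  -- The fundamental cut of the tree edge from z to `p z`. As an inequality of Booleans it is
  -- symmetric by `sym`, and its negation is stably an equality, which composes by `trans`.
  Separates : Fin n → Fin n → Fin n → Set
  Separates z u v = below z u ≢ below z v

  separates? : ∀ z u v → Dec (Separates z u v)
  separates? z u v = ¬? (below z u Bool.≟ below z v)

  separates⁺ : ∀ {z u v} → u ⊑ z → ¬ v ⊑ z → Separates z u v
  separates⁺ {z} {u} {v} u⊑z v⋢z with u ⊑? z | v ⊑? z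
  ... | yes _  | no _  = λ ()
  ... | no u⋢z | _     = ⊥-elim (u⋢z u⊑z)
  ... | _      | yes v⊑z = ⊥-elim (v⋢z v⊑z)

  separates⁻ : ∀ {z u v} → Separates z u v → (u ⊑ z × ¬ v ⊑ z) ⊎ (v ⊑ z × ¬ u ⊑ z)
  separates⁻ {z} {u} {v} s with u ⊑? z | v ⊑? z
  ... | yes a | no b  = inj₁ (a , b)
  ... | no a  | yes b = inj₂ (b , a)
  ... | yes _ | yes _ = ⊥-elim (s refl)
  ... | no _  | no _  = ⊥-elim (s refl)

  ¬separates : ∀ {z u v} → ¬ Separates z u v → u ⊑ z → v ⊑ z
  ¬separates ¬s u⊑z = decidable-stable (_ ⊑? _) λ v⋢z → ¬s (separates⁺ u⊑z v⋢z)

  separates-tree-edge : ∀ {z a} → a ≢ r → Separates z a (p a) → a ≡ z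
  separates-tree-edge {z} {a} a≢r s with separates⁻ s
  ... | inj₁ (a⊑z , pa⋢z) = decidable-stable (a ≟ z) λ a≢z → pa⋢z (proj₂ (⊑-split a⊑z a≢z))
  ... | inj₂ (pa⊑z , a⋢z) = ⊥-elim (a⋢z (up a≢r pa⊑z))

  p⋢ : ∀ {x} → x ≢ r → ¬ p x ⊑ x
  p⋢ x≢r q = n≮n _ (ℕ.<-≤-trans (p< x≢r) (⊑-depth q))

  -- Subtrees are laminar: y ∩ z, y − z and z − y are not all inhabited.
  no-four-corners : ∀ {y z s t w} → s ⊑ y → s ⊑ z → t ⊑ y → ¬ t ⊑ z → w ⊑ z → ¬ w ⊑ y → ⊥
  no-four-corners sy sz ty t⋢z wz w⋢y with ⊑-laminar sy sz
  ... | inj₁ y⊑z = t⋢z (⊑-trans ty y⊑z)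
  ... | inj₂ z⊑y = w⋢y (⊑-trans wz z⊑y)

  -- Every bridge of G is a tree edge, so it can be named by its lower end; a tree edge is a bridge
  -- when it is alone in its fundamental cut.
  Bridge : Fin n → Set
  Bridge x = x ≢ r × (∀ a b → Adj G a b → a ⊑ x → ¬ b ⊑ x → a ≡ x × b ≡ p x)

  abstract
    bridge? : Decidable Bridge
    bridge? x = ¬? (x ≟ r) ×-dec all? λ a → all? λ b →
      T? _ →-dec (a ⊑? x →-dec (¬? (b ⊑? x) →-dec (a ≟ x ×-dec b ≟ p x)))

  bridge-crossing : ∀ {x a b} → Bridge x → Adj G a b → Separates x a b → (a ≡ x × b ≡ p x) ⊎ (b ≡ x × a ≡ p x)
  bridge-crossing (_ , br) e s with separates⁻ s
  ... | inj₁ (a⊑x , b⋢x) = inj₁ (br _ _ e a⊑x b⋢x)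
  ... | inj₂ (b⊑x , a⋢x) = inj₂ (br _ _ (Adj-sym G e) b⊑x a⋢x)

  non-bridge-crossing : ∀ {z} → z ≢ r → ¬ Bridge z →
    ∃[ a ] ∃[ b ] Adj G a b × a ⊑ z × ¬ b ⊑ z × ¬ (a ≡ z × b ≡ p z)
  non-bridge-crossing {z} z≢r ¬br with any? (λ a → any? λ b →
      T? (adj G a b) ×-dec (a ⊑? z ×-dec (¬? (b ⊑? z) ×-dec ¬? (a ≟ z ×-dec b ≟ p z))))
  ... | yes found = found
  ... | no ¬found = ⊥-elim (¬br (z≢r , λ a b e a⊑z b⋢z →
          decidable-stable (a ≟ z ×-dec b ≟ p z) λ ¬eq → ¬found (a , b , e , a⊑z , b⋢z , ¬eq)))

  -- The 2-edge-connected components are represented by their topmost vertices.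
  IsTop : Fin n → Set
  IsTop c = c ≡ r ⊎ Bridge c

  isTop? : Decidable IsTop
  isTop? c = c ≟ r ⊎-dec bridge? c

  private
    Top : Fin n → Set
    Top w = ∃[ c ] w ⊑ c × IsTop c × (∀ {x} → Bridge x → w ⊑ x → c ⊑ x)

    findTop : ∀ w → Top w
    findTop = tree-induction Top (r , here , inj₁ refl , λ _ q → q) step
      where
      step : ∀ {v} → v ≢ r → Top (p v) → Top v
      step {v} v≢r (c , pv⊑c , tc , min) with bridge? v
      ... | yes br = v , here , inj₂ br , λ _ q → q
      ... | no ¬br = c , up v≢r pv⊑c , tc , λ {x} bx v⊑x →
        min bx (proj₂ (⊑-split v⊑x λ { refl → ¬br bx }))

  abstract
    top : Fin n → Fin n
    top w = proj₁ (findTop w)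

    ⊑-top : ∀ w → w ⊑ top w
    ⊑-top w = proj₁ (proj₂ (findTop w))

    isTop-top : ∀ w → IsTop (top w)
    isTop-top w = proj₁ (proj₂ (proj₂ (findTop w)))

    top-least : ∀ {w x} → Bridge x → w ⊑ x → top w ⊑ x
    top-least {w} = proj₂ (proj₂ (proj₂ (findTop w)))

  top-unique : ∀ {w c} → w ⊑ c → IsTop c → (∀ {x} → Bridge x → w ⊑ x → c ⊑ x) → top w ≡ c
  top-unique {w} {c} w⊑c tc min = ⊑-antisym (down tc) (up′ (isTop-top w))
    where
    down : IsTop c → top w ⊑ c
    down (inj₁ refl) = ⊑-r _
    down (inj₂ bc)   = top-least bc w⊑c
    up′ : IsTop (top w) → c ⊑ top w
    up′ (inj₁ eq) = subst (c ⊑_) (sym eq) (⊑-r _)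
    up′ (inj₂ bt) = min bt (⊑-top w)

  top-isTop : ∀ {c} → IsTop c → top c ≡ c
  top-isTop tc = top-unique here tc (λ _ q → q)

  top-bridge : ∀ {c} → Bridge c → top c ≡ c
  top-bridge = top-isTop ∘ inj₂

  -- An edge that is not itself a bridge crosses no bridge cut, so its ends lie below the same
  -- bridges and share their topmost vertex.
  top-edge : ∀ {a b} → Adj G a b → top a ≢ top b → (Bridge a × p a ≡ b) ⊎ (Bridge b × p b ≡ a)
  top-edge {a} {b} e top≢ with bridge? a ×-dec p a ≟ b | bridge? b ×-dec p b ≟ a
  ... | yes q | _     = inj₁ q
  ... | no _  | yes q = inj₂ q
  ... | no ¬q | no ¬q′ = ⊥-elim (top≢ (top-unique (a⊑ (isTop-top b)) (isTop-top b)
          λ bx a⊑x → top-least bx (¬separates (same bx) a⊑x)))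
    where
    same : ∀ {x} → Bridge x → ¬ Separates x a b
    same bx s with bridge-crossing bx e s
    ... | inj₁ (refl , eq) = ¬q (bx , sym eq)
    ... | inj₂ (refl , eq) = ¬q′ (bx , sym eq)
    a⊑ : IsTop (top b) → a ⊑ top b
    a⊑ (inj₁ eq) = subst (a ⊑_) (sym eq) (⊑-r a)
    a⊑ (inj₂ bt) = ¬separates (same bt ∘ (_∘ sym)) (⊑-top b)

  Child : Fin n → Fin n → Set
  Child c x = Bridge x × top (p x) ≡ c

  child? : ∀ c x → Dec (Child c x)
  child? c x = bridge? x ×-dec top (p x) ≟ c

  child-depth : ∀ {c x} → Child c x → depth c < depth x
  child-depth {x = x} ((x≢r , _) , refl) = ℕ.≤-<-trans (⊑-depth (⊑-top (p x))) (p< x≢r)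

  -- Were x strictly below y, then `p x`, and with it the whole component c, would lie below the
  -- bridge y; but y hangs from c and is deeper than its topmost vertex.
  children-disjoint : ∀ {c x y w} → Child c x → Child c y → w ⊑ x → w ⊑ y → x ≡ y
  children-disjoint cx cy wx wy = [ nested cx cy , sym ∘ nested cy cx ]′ (⊑-laminar wx wy)
    where
    nested : ∀ {c x y} → Child c x → Child c y → x ⊑ y → x ≡ y
    nested {c} {x} {y} (bx , refl) cy@(by , _) x⊑y = decidable-stable (x ≟ y) λ x≢y →
      n≮n _ (ℕ.<-≤-trans (child-depth cy) (⊑-depth (top-least by (proj₂ (⊑-split x⊑y x≢y)))))

  -- A component is matched when it has an unmatched child, to which it is then matched:
  -- a greedy maximum matching of the bridge tree, found from the leaves up.
  Matched : Fin n → Set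
  Matched = Winning child? depth child-depth

  matched? : Decidable Matched
  matched? = winning? child? depth child-depth

  matched⁺ : ∀ {c x} → Child c x → ¬ Matched x → Matched c
  matched⁺ = winning⁺ child? depth child-depth

  mate : ∀ c → Matched c → ∃[ x ] Child c x × ¬ Matched x
  mate c = winning⁻ child? depth child-depth

  -- Mates belong here too: only the upper end of a matching edge is `Matched`. The matched
  -- components form a vertex cover of the bridge tree with one member for each edge of the
  -- matching, and this is the complementary independent set of König's theorem.
  Unmatched : Fin n → Set
  Unmatched c = IsTop c × ¬ Matched c

  unmatched? : Decidable Unmatched
  unmatched? c = isTop? c ×-dec ¬? (matched? c)

  unmatched-independent : ∀ {c d} → Unmatched c → Unmatched d → ¬ Adj G c d
  unmatched-independent {c} {d} (tc , ¬mc) (td , ¬md) e with top c ≟ top d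
  ... | yes eq = loopless G c (subst (Adj G c) (trans (sym (top-isTop td)) (trans (sym eq) (top-isTop tc))) e)
  ... | no neq with top-edge e neq
  ... | inj₁ (bc , refl) = ¬md (matched⁺ (bc , top-isTop td) ¬mc)
  ... | inj₂ (bd , refl) = ¬mc (matched⁺ (bd , top-isTop tc) ¬md)

-- Walks and conflict-free colourings

module _ {n} (G : Graph n) where

  AllEdges : (∀ a b → Adj G a b → Set) → ∀ {u v} → Walk G u v → Set
  AllEdges Q ε       = ⊤
  AllEdges Q (e ◅ w) = Q _ _ e × AllEdges Q w

  AllEdges-map : ∀ {Q R : ∀ a b → Adj G a b → Set} → (∀ {a b} e → Q a b e → R a b e) →
                 ∀ {u v} (w : Walk G u v) → AllEdges Q w → AllEdges R w
  AllEdges-map h ε       _        = tt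
  AllEdges-map h (e ◅ w) (q , qs) = h e q , AllEdges-map h w qs

  AllEdges-◅◅ : ∀ (Q : ∀ a b → Adj G a b → Set) {u v x} (w : Walk G u v) (w′ : Walk G v x) →
                AllEdges Q w → AllEdges Q w′ → AllEdges Q (w ◅◅ w′)
  AllEdges-◅◅ Q ε       w′ _        qs′ = qs′
  AllEdges-◅◅ Q (e ◅ w) w′ (q , qs) qs′ = q , AllEdges-◅◅ Q w w′ qs qs′

occurrences : ∀ {c} → Fin c → List (Fin c) → ℕ
occurrences x xs = length (filter (x Fin.≟_) xs)

occurrences-++ : ∀ {c} (x : Fin c) xs ys → occurrences x (xs ++ ys) ≡ occurrences x xs + occurrences x ys
occurrences-++ x xs ys = trans (cong length (filter-++ (x Fin.≟_) xs ys)) (length-++ (filter (x Fin.≟_) xs))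

occurrences-∷ : ∀ {c} (x y : Fin c) xs → occurrences x xs ≤ occurrences x (y ∷ xs)
occurrences-∷ x y xs = ≤-trans (ℕ.m≤n+m _ _) (≤-reflexive (sym (occurrences-++ x [ y ] xs)))

occurrences-∷-mono : ∀ {c} (x y : Fin c) {xs ys} → occurrences x xs ≤ occurrences x ys →
                     occurrences x (y ∷ xs) ≤ occurrences x (y ∷ ys)
occurrences-∷-mono x y {xs} {ys} le rewrite occurrences-++ x [ y ] xs | occurrences-++ x [ y ] ys = ℕ.+-monoʳ-≤ _ le

module _ {c} {A : Set} (f : A → Fin c) (x : Fin c) where

  occurrences-none : ∀ zs → (∀ {z} → z ∈ zs → f z ≢ x) → occurrences x (map f zs) ≡ 0
  occurrences-none zs h = cong length (filter-none (x Fin.≟_) (All.map⁺ (All.tabulate λ z∈ eq → h z∈ (sym eq))))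

  occurrences-one : ∀ {y} zs → Unique zs → (∀ {z} → z ∈ zs → f z ≡ x → z ≡ y) → occurrences x (map f zs) ≤ 1
  occurrences-one [] _ _ = z≤n
  occurrences-one (z ∷ zs) (z∉zs ∷ u) h with x Fin.≟ f z
  ... | no _   = occurrences-one zs u (h ∘ there)
  ... | yes eq = s≤s (≤-reflexive (occurrences-none zs λ z′∈ eq′ →
          All.lookup z∉zs z′∈ (trans (h (here refl) (sym eq)) (sym (h (there z′∈) eq′)))))

module _ {n} {G : Graph n} {c} (f : EdgeColouring G c) where

  colours-◅◅ : ∀ {u v x} (w : Walk G u v) (w′ : Walk G v x) → colours f (w ◅◅ w′) ≡ colours f w ++ colours f w′
  colours-◅◅ ε       w′ = refl
  colours-◅◅ (e ◅ w) w′ = cong (colour f e ∷_) (colours-◅◅ w w′)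

  module _ (Q : ∀ a b → Adj G a b → Set) (x : Fin c) where

    -- Removing detours may lower the number of edges of colour x, so only an upper bound survives;
    -- the matching lower bound is recovered from a cut in `conflict-free-path`.
    Shortcut : ∀ {u v a} → Walk G u v → Walk G a v → Set
    Shortcut w w′ = occurrences x (colours f w′) ≤ occurrences x (colours f w) × (AllEdges G Q w → AllEdges G Q w′)

    suffix : ∀ {u v a} (w : Walk G u v) → IsPath G w → a ∈ vertices G w →
             Σ[ w′ ∈ Walk G a v ] IsPath G w′ × Shortcut w w′
    suffix ε       path (here refl) = ε , path , ≤-refl , id
    suffix (e ◅ w) path (here refl) = e ◅ w , path , ≤-refl , id
    suffix (e ◅ w) (_ ∷ path) (there a∈) =
      let w′ , path′ , le , q = suffix w path a∈
      in w′ , path′ , ≤-trans le (occurrences-∷ x (colour f e) (colours f w)) , q ∘ proj₂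

    walk⇒path : ∀ {u v} (w : Walk G u v) → Σ[ w′ ∈ Walk G u v ] IsPath G w′ × Shortcut w w′
    walk⇒path ε = ε , [] ∷ [] , ≤-refl , id
    walk⇒path {u} (e ◅ w) with walk⇒path w
    ... | w′ , path , le , q with DecMembership._∈?_ (Fin._≟_ {n}) u (vertices G w′)
    ... | no u∉   = e ◅ w′ , All.¬Any⇒All¬ _ u∉ ∷ path ,
                    occurrences-∷-mono x (colour f e) le , λ (a , b) → a , q b
    ... | yes u∈ = let w″ , path′ , le′ , q′ = suffix w′ path u∈ in
          w″ , path′ , ≤-trans le′ (≤-trans le (occurrences-∷ x (colour f e) (colours f w))) , q′ ∘ q ∘ proj₂

  cut-crossed : ∀ (A : Fin n → Bool) x {u v} (w : Walk G u v) →
                AllEdges G (λ a b e → A a ≢ A b → colour f e ≡ x) w → A u ≢ A v → 1 ≤ occurrences x (colours f w)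
  cut-crossed A x ε _ u≢v = ⊥-elim (u≢v refl)
  cut-crossed A x {u} (_◅_ {j = b} e w) (q , qs) u≢v with A u Bool.≟ A b
  ... | yes eq = ≤-trans (cut-crossed A x w qs λ eq′ → u≢v (trans eq eq′)) (occurrences-∷ x (colour f e) (colours f w))
  ... | no neq rewrite filter-accept (x Fin.≟_) {xs = colours f w} (sym (q neq)) = s≤s z≤n

  -- A path extracted from a walk still has to cross every cut separating its ends.
  conflict-free-path : ∀ (A : Fin n → Bool) x {u v} (w : Walk G u v) →
                       AllEdges G (λ a b e → A a ≢ A b → colour f e ≡ x) w → A u ≢ A v →
                       occurrences x (colours f w) ≤ 1 → Σ[ w ∈ Walk G u v ] IsPath G w × ConflictFree f w
  conflict-free-path A x w cross u≢v le =
    let w′ , path , le′ , q = walk⇒path _ x w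
    in w′ , path , x , ℕ.≤-antisym (≤-trans le′ le) (cut-crossed A x w′ (q cross) u≢v)

module _ {n} {G : Graph n} {r : Fin n} (tree : SpanningTree G r) {c} (f : EdgeColouring G c) where
  open Rooted tree

  Incident : Fin n → Fin n → Set
  Incident a z = a ≡ z ⊎ a ≡ p z

  TreeEdgeOf : List (Fin n) → ∀ a b → Adj G a b → Set
  TreeEdgeOf zs a b _ = ∃[ z ] z ∈ zs × z ≢ r × ((a ≡ z × b ≡ p z) ⊎ (b ≡ z × a ≡ p z))

  module _ (col : Fin n → Fin c) (col-up : ∀ {z} (e : Adj G z (p z)) → z ≢ r → colour f e ≡ col z) where

    col-down : ∀ {z} (e : Adj G (p z) z) → z ≢ r → colour f e ≡ col z
    col-down e z≢r = trans (undirected f e (Adj-sym G e)) (col-up (Adj-sym G e) z≢r)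

    -- A tree edge is named by its lower end.
    record TreeWalk (u v : Fin n) : Set where
      field
        walk      : Walk G u v
        edges     : List (Fin n)
        unique    : Unique edges
        coloured  : colours f walk ≡ map col edges
        traversed : AllEdges G (TreeEdgeOf edges) walk
        separate  : ∀ {z} → z ∈ edges → z ≢ r × Separates z u v
        ends      : u ≢ v → (∃[ z ] z ∈ edges × Incident u z) × (∃[ z ] z ∈ edges × Incident v z)
        alone     : u ≢ v → (∃[ z ] edges ≡ [ z ]) ⊎
                    (∃[ z ] ∃[ z′ ] ∃[ a ] z ∈ edges × z′ ∈ edges × z ≢ z′ × Incident a z × Incident a z′)

    -- Recursion at the deeper of the two ends: the other end is not below it, so its parent edge
    -- separates them. The field `ends` is what lets `alone` exhibit the vertex shared by the new
    -- edge and an earlier one.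
    treeWalk : ∀ u v → TreeWalk u v
    treeWalk u v = go _ u v ≤-refl
      where
      nil : ∀ v → TreeWalk v v
      nil v = record
        { walk = ε ; edges = [] ; unique = [] ; coloured = refl ; traversed = tt
        ; separate = λ () ; ends = λ v≢v → ⊥-elim (v≢v refl) ; alone = λ v≢v → ⊥-elim (v≢v refl) }

      ascend : ∀ {u v} → u ≢ r → ¬ v ⊑ u → TreeWalk (p u) v → TreeWalk u v
      ascend {u} {v} u≢r v⋢u t with p u ≟ v
      ... | yes refl = record
        { walk = p-adj u≢r ◅ ε ; edges = [ u ] ; unique = [] ∷ []
        ; coloured = cong [_] (col-up _ u≢r)
        ; traversed = (u , here refl , u≢r , inj₁ (refl , refl)) , tt
        ; separate = λ { (here refl) → u≢r , separates⁺ here v⋢u }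
        ; ends = λ _ → (u , here refl , inj₁ refl) , (u , here refl , inj₂ refl)
        ; alone = λ _ → inj₁ (u , refl) }
      ... | no pu≢v = record
        { walk = p-adj u≢r ◅ walk ; edges = u ∷ edges
        ; unique = All.tabulate (λ z∈ u≡z → fresh z∈ u≡z) ∷ unique
        ; coloured = cong₂ _∷_ (col-up _ u≢r) coloured
        ; traversed = (u , here refl , u≢r , inj₁ (refl , refl)) ,
            AllEdges-map G (λ _ (z , z∈ , q) → z , there z∈ , q) walk traversed
        ; separate = λ { (here refl) → u≢r , separates⁺ here v⋢u
                       ; (there z∈) → proj₁ (separate z∈) , λ eq → proj₂ (separate z∈) (trans (sym (same z∈)) eq) }
        ; ends = λ _ → (u , here refl , inj₁ refl) , (let z , z∈ , i = proj₂ (ends pu≢v) in z , there z∈ , i)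
        ; alone = λ _ → let z , z∈ , i = proj₁ (ends pu≢v) in
            inj₂ (u , z , p u , here refl , there z∈ , fresh z∈ , inj₂ refl , i) }
        where
        open TreeWalk t
        fresh : ∀ {z} → z ∈ edges → u ≢ z
        fresh z∈ refl with separates⁻ (proj₂ (separate z∈))
        ... | inj₁ (pu⊑u , _) = p⋢ u≢r pu⊑u
        ... | inj₂ (v⊑u , _)  = v⋢u v⊑u
        same : ∀ {z} → z ∈ edges → below z u ≡ below z (p u)
        same {z} z∈ = decidable-stable (_ Bool.≟ _) λ s → fresh z∈ (separates-tree-edge u≢r s)

      descend : ∀ {u v} → v ≢ r → ¬ u ⊑ v → TreeWalk u (p v) → TreeWalk u v
      descend {u} {v} v≢r u⋢v t with u ≟ p v
      ... | yes refl = record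
        { walk = Adj-sym G (p-adj v≢r) ◅ ε ; edges = [ v ] ; unique = [] ∷ []
        ; coloured = cong [_] (col-down _ v≢r)
        ; traversed = (v , here refl , v≢r , inj₂ (refl , refl)) , tt
        ; separate = λ { (here refl) → v≢r , separates⁺ here u⋢v ∘ sym }
        ; ends = λ _ → (v , here refl , inj₂ refl) , (v , here refl , inj₁ refl)
        ; alone = λ _ → inj₁ (v , refl) }
      ... | no u≢pv = record
        { walk = walk ◅◅ last ; edges = edges ++ [ v ]
        ; unique = Unique.++⁺ unique ([] ∷ []) λ { (z∈ , here refl) → fresh z∈ refl }
        ; coloured = trans (colours-◅◅ f walk last)
            (trans (cong₂ _++_ coloured (cong [_] (col-down _ v≢r))) (sym (map-++ col edges [ v ])))
        ; traversed = AllEdges-◅◅ G (TreeEdgeOf (edges ++ [ v ])) walk last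
            (AllEdges-map G (λ _ (z , z∈ , q) → z , ∈-++⁺ˡ z∈ , q) walk traversed)
            ((v , v∈ , v≢r , inj₂ (refl , refl)) , tt)
        ; separate = λ z∈ → [ (λ z∈ → proj₁ (separate z∈) , λ eq → proj₂ (separate z∈) (trans eq (same z∈)))
                            , (λ { (here refl) → v≢r , separates⁺ here u⋢v ∘ sym }) ]′ (∈-++⁻ edges z∈)
        ; ends = λ _ → (let z , z∈ , i = proj₁ (ends u≢pv) in z , ∈-++⁺ˡ z∈ , i) , (v , v∈ , inj₁ refl)
        ; alone = λ _ → let z , z∈ , i = proj₂ (ends u≢pv) in
            inj₂ (v , z , p v , v∈ , ∈-++⁺ˡ z∈ , fresh z∈ , inj₂ refl , i) }
        where
        open TreeWalk t
        last = Adj-sym G (p-adj v≢r) ◅ ε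
        v∈ : v ∈ edges ++ [ v ]
        v∈ = ∈-++⁺ʳ edges (here refl)
        fresh : ∀ {z} → z ∈ edges → v ≢ z
        fresh z∈ refl with separates⁻ (proj₂ (separate z∈))
        ... | inj₁ (u⊑v , _)  = u⋢v u⊑v
        ... | inj₂ (pv⊑v , _) = p⋢ v≢r pv⊑v
        same : ∀ {z} → z ∈ edges → below z v ≡ below z (p v)
        same {z} z∈ = decidable-stable (_ Bool.≟ _) λ s → fresh z∈ (separates-tree-edge v≢r s)

      deeper≢r : ∀ {u v} → u ≢ v → depth v ≤ depth u → u ≢ r
      deeper≢r u≢v le refl = u≢v (sym (⊑-depth-≡ (⊑-r _) le))

      go : ∀ d u v → depth u + depth v ≤ d → TreeWalk u v
      go d u v le with u ≟ v
      ... | yes refl = nil v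
      ... | no u≢v with ℕ.≤-total (depth v) (depth u)
      go zero u v le | no u≢v | inj₁ v≤u = ⊥-elim (ℕ.n≮0 (ℕ.<-≤-trans
        (ℕ.<-≤-trans (p< (deeper≢r u≢v v≤u)) (ℕ.m≤m+n _ _)) le))
      go zero u v le | no u≢v | inj₂ u≤v = ⊥-elim (ℕ.n≮0 (ℕ.<-≤-trans
        (ℕ.<-≤-trans (p< (deeper≢r (u≢v ∘ sym) u≤v)) (ℕ.m≤n+m _ _)) le))
      go (suc d) u v le | no u≢v | inj₁ v≤u =
        ascend u≢r (λ v⊑u → u≢v (sym (⊑-depth-≡ v⊑u v≤u)))
          (go d (p u) v (ℕ.≤-pred (ℕ.<-≤-trans (ℕ.+-monoˡ-< (depth v) (p< u≢r)) le)))
        where u≢r = deeper≢r u≢v v≤u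
      go (suc d) u v le | no u≢v | inj₂ u≤v =
        descend v≢r (λ u⊑v → u≢v (⊑-depth-≡ u⊑v u≤v))
          (go d u (p v) (ℕ.≤-pred (ℕ.<-≤-trans (ℕ.+-monoʳ-< (depth u) (p< v≢r)) le)))
        where v≢r = deeper≢r (u≢v ∘ sym) u≤v

module _ {A : Set} (_∈?_ : ∀ (x : A) xs → Dec (x ∈ xs)) (xs : List A) {k} (few : length xs ≤ k) where

  indexColour : A → Fin (suc k)
  indexColour z with z ∈? xs
  ... | yes z∈ = suc (Fin.inject≤ (Any.index z∈) few)
  ... | no _   = zero

  indexColour-∉ : ∀ {z} → z ∉ xs → indexColour z ≡ zero
  indexColour-∉ {z} z∉ with z ∈? xs
  ... | yes z∈ = ⊥-elim (z∉ z∈)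
  ... | no _   = refl

  indexColour-injective : ∀ {y z} → y ∈ xs → indexColour z ≡ indexColour y → z ≡ y
  indexColour-injective {y} {z} y∈ eq with z ∈? xs | y ∈? xs
  ... | _      | no y∉   = ⊥-elim (y∉ y∈)
  ... | yes z∈ | yes y∈′ = trans (Any.lookup-index z∈)
          (trans (cong (lookup xs) (Fin.inject≤-injective few few _ _ (Fin.suc-injective eq)))
                 (sym (Any.lookup-index y∈′)))

-- The matching of bridges and the colouring

module _ {n} {G : Graph n} {r : Fin n} (tree : SpanningTree G r) where
  open Rooted tree

  -- For an unmatched c the value is c itself, which is not a child of c.
  mateOf : Fin n → Fin n
  mateOf c with matched? c
  ... | yes m = proj₁ (mate c m)
  ... | no _  = c

  Mate : Fin n → Set
  Mate x = Bridge x × mateOf (top (p x)) ≡ x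

  mateOf-matched : ∀ {c} → Matched c → Child c (mateOf c) × ¬ Matched (mateOf c)
  mateOf-matched {c} m with matched? c
  ... | yes m′ = proj₂ (mate c m′)
  ... | no ¬m  = ⊥-elim (¬m m)

  mate-matched : ∀ {x} → Mate x → Matched (top (p x)) × ¬ Matched x
  mate-matched {x} (bx , eq) with matched? (top (p x))
  ... | yes m = m , subst (¬_ ∘ Matched) eq (proj₂ (proj₂ (mate _ m)))
  ... | no _  = ⊥-elim (n≮n _ (ℕ.≤-trans (child-depth (bx , refl)) (≤-reflexive (cong depth (sym eq)))))

  -- The mates are a matching: the component above a mate is matched and the mate itself is not,
  -- which excludes two mates in a chain, while two mates hanging from one component are both its
  -- `mateOf`.
  mates-disjoint : ∀ {x y a} → Mate x → Mate y → a ≡ x ⊎ a ≡ p x → a ≡ y ⊎ a ≡ p y → x ≡ y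
  mates-disjoint mx my (inj₁ refl) (inj₁ refl) = refl
  mates-disjoint mx my (inj₁ refl) (inj₂ refl) =
    ⊥-elim (proj₂ (mate-matched mx) (subst Matched (top-bridge (proj₁ mx)) (proj₁ (mate-matched my))))
  mates-disjoint mx my (inj₂ refl) (inj₁ refl) =
    ⊥-elim (proj₂ (mate-matched my) (subst Matched (top-bridge (proj₁ my)) (proj₁ (mate-matched mx))))
  mates-disjoint mx my (inj₂ refl) (inj₂ eq) =
    trans (sym (proj₂ mx)) (trans (cong (mateOf ∘ top) eq) (proj₂ my))

  private
    nonMate? : Decidable (λ x → Bridge x × ¬ mateOf (top (p x)) ≡ x)
    nonMate? x = bridge? x ×-dec ¬? (mateOf (top (p x)) ≟ x)

  nonMates : List (Fin n)
  nonMates = filter nonMate? (allFin n)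

  ∈nonMates⁻ : ∀ {x} → x ∈ nonMates → Bridge x
  ∈nonMates⁻ x∈ = proj₁ (proj₂ (∈-filter⁻ nonMate? {xs = allFin n} x∈))

  nonMates-unique : Unique nonMates
  nonMates-unique = Unique.filter⁺ nonMate? (Unique.allFin⁺ n)

  ∈nonMates⇒¬Mate : ∀ {x} → x ∈ nonMates → ¬ Mate x
  ∈nonMates⇒¬Mate x∈ m = proj₂ (proj₂ (∈-filter⁻ nonMate? {xs = allFin n} x∈)) (proj₂ m)

  ∉nonMates⁻ : ∀ {x} → Bridge x → x ∉ nonMates → Mate x
  ∉nonMates⁻ {x} bx x∉ = bx , decidable-stable (_ ≟ x) λ neq → x∉ (∈-filter⁺ nonMate? (∈-allFin x) (bx , neq))

  -- Non-mate bridges get the colours 1, 2, …, all other tree edges the colour 0, and the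
  -- edges off the tree share the colour 1 with at most one bridge.  A tree path without a
  -- non-mate bridge either is a single mate, or contains an edge z that is not a bridge;
  -- exchanging z for an edge across the cut of z yields a walk with one edge off the tree.
  module _ {k} (few : length nonMates ≤ suc k) where

    private
      module ∈ᵈ = DecMembership (Fin._≟_ {n})

      -- Sharing this colour with the first non-mate does no harm: edges off the tree are used only
      -- between vertices that no non-mate separates.
      t : Fin (suc (suc k))
      t = suc zero

      col : Fin n → Fin (suc (suc k))
      col = indexColour ∈ᵈ._∈?_ nonMates few

      edgeColour : Fin n → Fin n → Fin (suc (suc k))
      edgeColour u v with ¬? (u ≟ r) ×-dec p u ≟ v | ¬? (v ≟ r) ×-dec p v ≟ u
      ... | yes _ | _     = col u
      ... | no _  | yes _ = col v
      ... | no _  | no _  = t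

      edgeColour-sym : ∀ u v → edgeColour u v ≡ edgeColour v u
      edgeColour-sym u v with ¬? (u ≟ r) ×-dec p u ≟ v | ¬? (v ≟ r) ×-dec p v ≟ u
      ... | yes (u≢r , refl) | yes (v≢r , eq) =
              ⊥-elim (ℕ.<-asym (p< u≢r) (subst (λ w → depth w < depth (p u)) eq (p< v≢r)))
      ... | yes _ | no _  = refl
      ... | no _  | yes _ = refl
      ... | no _  | no _  = refl

      edgeColour-up : ∀ {z} → z ≢ r → edgeColour z (p z) ≡ col z
      edgeColour-up {z} z≢r with ¬? (z ≟ r) ×-dec p z ≟ p z | ¬? (p z ≟ r) ×-dec p (p z) ≟ z
      ... | yes _ | _ = refl
      ... | no ¬q | _ = ⊥-elim (¬q (z≢r , refl))

      edgeColour-off : ∀ {u v} → ¬ (u ≢ r × p u ≡ v) → ¬ (v ≢ r × p v ≡ u) → edgeColour u v ≡ t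
      edgeColour-off {u} {v} ¬up ¬down with ¬? (u ≟ r) ×-dec p u ≟ v | ¬? (v ≟ r) ×-dec p v ≟ u
      ... | yes q | _     = ⊥-elim (¬up q)
      ... | no _  | yes q = ⊥-elim (¬down q)
      ... | no _  | no _  = refl

      f : EdgeColouring G (suc (suc k))
      f = record { colour = λ {u} {v} _ → edgeColour u v ; undirected = λ {u} {v} _ _ → edgeColour-sym u v }

      tw : ∀ u v → TreeWalk tree f col (λ _ → edgeColour-up) u v
      tw = treeWalk tree f col (λ _ → edgeColour-up)

      open module TW {u v} (w : TreeWalk tree f col (λ _ → edgeColour-up) u v) = TreeWalk w

      CFPath : Fin n → Fin n → Set
      CFPath u v = Σ[ w ∈ Walk G u v ] IsPath G w × ConflictFree f w

      tree-path : ∀ {u v y} (w : TreeWalk tree f col (λ _ → edgeColour-up) u v) → Separates y u v →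
                  (∀ {z} → z ∈ edges w → col z ≡ col y → z ≡ y) → CFPath u v
      tree-path {u} {v} {y} w sep only = conflict-free-path f (below y) (col y) (walk w)
        (AllEdges-map G crossing (walk w) (traversed w)) sep
        (≤-trans (≤-reflexive (cong (occurrences (col y)) (coloured w)))
                 (occurrences-one col (col y) (edges w) (unique w) only))
        where
        crossing : ∀ {a b} (e : Adj G a b) → TreeEdgeOf tree f (edges w) a b e →
                   Separates y a b → edgeColour a b ≡ col y
        crossing e (z , _ , z≢r , inj₁ (refl , refl)) s =
          trans (edgeColour-up z≢r) (cong col (separates-tree-edge z≢r s))
        crossing e (z , _ , z≢r , inj₂ (refl , refl)) s =
          trans (edgeColour-sym (p z) z) (trans (edgeColour-up z≢r) (cong col (separates-tree-edge z≢r (s ∘ sym))))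

      swap-path : ∀ {u v z a b} → (∀ {y} → y ∈ nonMates → ¬ Separates y u v) → Adj G a b →
                  Separates z a b → ¬ Separates z u a → ¬ Separates z b v →
                  ¬ (a ≢ r × p a ≡ b) → ¬ (b ≢ r × p b ≡ a) → CFPath u v
      swap-path {u} {v} {z} {a} {b} none e zab ¬zua ¬zbv ¬up ¬down =
        conflict-free-path f (below z) t (walk w₁ ◅◅ (e ◅ walk w₂))
          (AllEdges-◅◅ G _ (walk w₁) (e ◅ walk w₂)
            (AllEdges-map G (crossing w₁ ¬zua) (walk w₁) (traversed w₁))
            ((λ _ → edgeColour-off ¬up ¬down) , AllEdges-map G (crossing w₂ ¬zbv) (walk w₂) (traversed w₂)))
          (λ eq → zab (trans (sym (same ¬zua)) (trans eq (sym (same ¬zbv)))))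
          (≤-reflexive count)
        where
        w₁ = tw u a
        w₂ = tw b v
        same : ∀ {z u v} → ¬ Separates z u v → below z u ≡ below z v
        same = decidable-stable (_ Bool.≟ _)
        crossing : ∀ {x x′} (w : TreeWalk tree f col (λ _ → edgeColour-up) x x′) → ¬ Separates z x x′ →
                   ∀ {a b} (e : Adj G a b) → TreeEdgeOf tree f (edges w) a b e → Separates z a b → edgeColour a b ≡ t
        crossing w ¬s e (y , y∈ , y≢r , inj₁ (refl , refl)) s with separates-tree-edge y≢r s
        ... | refl = ⊥-elim (¬s (proj₂ (separate w y∈)))
        crossing w ¬s e (y , y∈ , y≢r , inj₂ (refl , refl)) s with separates-tree-edge y≢r (s ∘ sym)
        ... | refl = ⊥-elim (¬s (proj₂ (separate w y∈)))
        ¬yab : ∀ {y} → Bridge y → ¬ Separates y a b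
        ¬yab by s with bridge-crossing by e s
        ... | inj₁ (refl , eq) = ¬up (proj₁ by , sym eq)
        ... | inj₂ (refl , eq) = ¬down (proj₁ by , sym eq)
        -- The bridge y separates neither u from v nor a from b. If it separated u from a, the cuts
        -- of y and z would put u, v, a and b into four different corners, which laminar subtrees do
        -- not allow.
        ¬yua : ∀ {y} → y ∈ nonMates → ¬ Separates y u a
        ¬yua y∈ s with separates⁻ s | separates⁻ zab
        ... | inj₁ (uy , a⋢y) | inj₁ (az , b⋢z) =
          no-four-corners uy (¬separates (¬zua ∘ (_∘ sym)) az) (¬separates (none y∈) uy)
            (b⋢z ∘ ¬separates (¬zbv ∘ (_∘ sym))) az a⋢y
        ... | inj₁ (uy , a⋢y) | inj₂ (bz , a⋢z) =
          no-four-corners (¬separates (none y∈) uy) (¬separates ¬zbv bz) uy (a⋢z ∘ ¬separates ¬zua) bz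
            (a⋢y ∘ ¬separates (¬yab (∈nonMates⁻ y∈) ∘ (_∘ sym)))
        ... | inj₂ (ay , u⋢y) | inj₁ (az , b⋢z) =
          no-four-corners ay az (¬separates (¬yab (∈nonMates⁻ y∈)) ay) b⋢z (¬separates (¬zua ∘ (_∘ sym)) az) u⋢y
        ... | inj₂ (ay , u⋢y) | inj₂ (bz , a⋢z) =
          no-four-corners (¬separates (¬yab (∈nonMates⁻ y∈)) ay) bz ay a⋢z (¬separates ¬zbv bz)
            (u⋢y ∘ ¬separates (none y∈ ∘ (_∘ sym)))
        ¬ybv : ∀ {y} → y ∈ nonMates → ¬ Separates y b v
        ¬ybv y∈ s = s (trans (sym (same (¬yab (∈nonMates⁻ y∈)))) (trans (sym (same (¬yua y∈))) (same (none y∈))))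
        no-t : ∀ {x x′} (w : TreeWalk tree f col (λ _ → edgeColour-up) x x′) →
               (∀ {y} → y ∈ nonMates → ¬ Separates y x x′) → occurrences t (colours f (walk w)) ≡ 0
        no-t w ¬s = trans (cong (occurrences t) (coloured w)) (occurrences-none col t (edges w) λ {y} y∈ eq →
          case y ∈ᵈ.∈? nonMates of λ
            { (yes y∈L) → ¬s y∈L (proj₂ (separate w y∈))
            ; (no y∉L)  → case trans (sym eq) (indexColour-∉ ∈ᵈ._∈?_ nonMates few y∉L) of λ () })
        count : occurrences t (colours f (walk w₁ ◅◅ (e ◅ walk w₂))) ≡ 1
        count = begin
          occurrences t (colours f (walk w₁ ◅◅ (e ◅ walk w₂)))
            ≡⟨ cong (occurrences t) (colours-◅◅ f (walk w₁) _) ⟩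
          occurrences t (colours f (walk w₁) ++ edgeColour a b ∷ colours f (walk w₂))
            ≡⟨ occurrences-++ t (colours f (walk w₁)) _ ⟩
          occurrences t (colours f (walk w₁)) + occurrences t (edgeColour a b ∷ colours f (walk w₂))
            ≡⟨ cong₂ _+_ (no-t w₁ ¬yua) (cong (λ c → occurrences t (c ∷ colours f (walk w₂))) (edgeColour-off ¬up ¬down)) ⟩
          suc (occurrences t (colours f (walk w₂)))
            ≡⟨ cong suc (no-t w₂ ¬ybv) ⟩
          1 ∎
          where open ≡-Reasoning

      inside : ∀ {z x y} → x ⊑ z → y ⊑ z → ¬ Separates z x y
      inside x⊑z y⊑z s = [ (λ q → proj₂ q y⊑z) , (λ q → proj₂ q x⊑z) ]′ (separates⁻ s)

      outside : ∀ {z x y} → ¬ x ⊑ z → ¬ y ⊑ z → ¬ Separates z x y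
      outside x⋢z y⋢z s = [ x⋢z ∘ proj₁ , y⋢z ∘ proj₁ ]′ (separates⁻ s)

      cf-path : ∀ u v → u ≢ v → CFPath u v
      cf-path u v u≢v with Any.any? (λ y → separates? y u v) nonMates
      ... | yes found = let y , y∈ , s = find found in
          tree-path (tw u v) s λ _ → indexColour-injective ∈ᵈ._∈?_ nonMates few y∈
      ... | no none with any? (λ z → ¬? (z ≟ r) ×-dec (¬? (bridge? z) ×-dec separates? z u v))
      ... | yes (z , z≢r , ¬bz , s) with non-bridge-crossing z≢r ¬bz
      ... | a , b , e , a⊑z , b⋢z , ¬zpz =
        [ (λ (u⊑z , v⋢z) → swap-path (λ y∈ s → none (lose y∈ s)) e (separates⁺ a⊑z b⋢z)
                             (inside u⊑z a⊑z) (outside b⋢z v⋢z) ¬up ¬down)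
        , (λ (v⊑z , u⋢z) → swap-path (λ y∈ s → none (lose y∈ s)) (Adj-sym G e) (separates⁺ a⊑z b⋢z ∘ sym)
                             (outside u⋢z b⋢z) (inside a⊑z v⊑z) ¬down ¬up) ]′ (separates⁻ s)
        where
        ¬up : ¬ (a ≢ r × p a ≡ b)
        ¬up (a≢r , refl) = ¬zpz (separates-tree-edge a≢r (separates⁺ a⊑z b⋢z) ,
                                 cong p (separates-tree-edge a≢r (separates⁺ a⊑z b⋢z)))
        ¬down : ¬ (b ≢ r × p b ≡ a)
        ¬down (b≢r , refl) = b⋢z (up b≢r a⊑z)
      cf-path u v u≢v | no none | no ¬nonBridge with alone (tw u v) u≢v
      ... | inj₁ (z , eq) = tree-path (tw u v)
              (proj₂ (separate (tw u v) (subst (z ∈_) (sym eq) (here refl))))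
              λ y∈ _ → case subst (_ ∈_) eq y∈ of λ { (here y≡z) → y≡z }
      ... | inj₂ (z , z′ , a , z∈ , z′∈ , z≢z′ , i , i′) = ⊥-elim (z≢z′ (mates-disjoint (mate∈ z∈) (mate∈ z′∈) i i′))
        where
        mate∈ : ∀ {y} → y ∈ edges (tw u v) → Mate y
        mate∈ {y} y∈ =
          let y≢r , s = separate (tw u v) y∈
              by = decidable-stable (bridge? y) λ ¬by → ¬nonBridge (y , y≢r , ¬by , s)
          in ∉nonMates⁻ by λ y∈L → none (lose y∈L s)

    conflict-free-colourable : ConflictFreeColourable G (suc (suc k))
    conflict-free-colourable = f , cf-path

-- Decidability of colourability

T-any? : ∀ {b} {P : T b → Set} → (∀ e → Dec (P e)) → Dec (Σ (T b) P)
T-any? {true}  P? = map′ (tt ,_) proj₂ (P? tt)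
T-any? {false} P? = no proj₁

Searchable : Set → Set₁
Searchable A = ∀ {P : A → Set} → Decidable P → Dec (∃ P)

search-Vec : ∀ {A} → Searchable A → ∀ m → Searchable (Vec A m)
search-Vec search zero    P? = map′ (Vec.[] ,_) (λ { (Vec.[] , q) → q }) (P? Vec.[])
search-Vec search (suc m) P? =
  map′ (λ (x , xs , q) → x Vec.∷ xs , q) (λ { (x Vec.∷ xs , q) → x , xs , q })
       (search λ x → search-Vec search m λ xs → P? (x Vec.∷ xs))

module _ {n} (G : Graph n) where

  steps : ∀ {u v} → Walk G u v → ℕ
  steps ε       = 0
  steps (_ ◅ w) = suc (steps w)

  length-vertices : ∀ {u v} (w : Walk G u v) → length (vertices G w) ≡ suc (steps w)
  length-vertices ε       = refl
  length-vertices (_ ◅ w) = cong suc (length-vertices w)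

  path-steps : ∀ {u v} (w : Walk G u v) → IsPath G w → steps w < n
  path-steps w path = begin-strict
    steps w                  <⟨ ≤-reflexive (sym (length-vertices w)) ⟩
    length (vertices G w)    ≤⟨ Unique-⊆-length path (λ {x} _ → ∈-allFin x) ⟩
    length (allFin n)        ≡⟨ length-tabulate id ⟩
    n                        ∎
    where open ≤-Reasoning

  walk-any? : ∀ l u v {Q : Walk G u v → Set} → Decidable Q → Dec (Σ[ w ∈ Walk G u v ] steps w ≡ l × Q w)
  walk-any? zero u v Q? with u ≟ v
  ... | no u≢v   = no λ { (ε , _) → u≢v refl ; (_ ◅ _ , () , _) }
  ... | yes refl = map′ (λ q → ε , refl , q) (λ { (ε , _ , q) → q ; (_ ◅ _ , () , _) }) (Q? ε)
  walk-any? (suc l) u v Q? =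
    map′ (λ (_ , e , w , eq , q) → e ◅ w , cong suc eq , q)
         (λ { (ε , () , _) ; (e ◅ w , eq , q) → _ , e , w , ℕ.suc-injective eq , q })
         (any? λ x → T-any? λ e → walk-any? l x v λ w → Q? (e ◅ w))

  module _ {c} (f : EdgeColouring G c) where

    conflictFreeConnected? : Dec (ConflictFreeConnected f)
    conflictFreeConnected? = all? λ u → all? λ v → ¬? (u ≟ v) →-dec
      map′ (λ (_ , w , _ , q) → w , q)
           (λ (w , path , cf) → Fin.fromℕ< (path-steps w path) , w , sym (Fin.toℕ-fromℕ< _) , path , cf)
           (any? λ l → walk-any? (toℕ l) u v λ w →
             AllPairs.allPairs? (λ x y → ¬? (x ≟ y)) (vertices G w) ×-dec any? λ x → _ ℕ.≟ 1)

  module _ {c} (f g : EdgeColouring G c) (agree : ∀ {u v} (e : Adj G u v) → colour f e ≡ colour g e) where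

    colours-agree : ∀ {u v} (w : Walk G u v) → colours f w ≡ colours g w
    colours-agree ε       = refl
    colours-agree (e ◅ w) = cong₂ _∷_ (agree e) (colours-agree w)

    conflictFreeConnected-agree : ConflictFreeConnected f → ConflictFreeConnected g
    conflictFreeConnected-agree cfc u v u≢v =
      let w , path , x , eq = cfc u v u≢v
      in w , path , x , subst (λ cs → occurrences x cs ≡ 1) (colours-agree w) eq

  module _ (c : ℕ) where

    private
      -- A finite search space for colourings: every colouring agrees on the edges with a symmetric
      -- matrix, filled with `zero` at the non-edges. The filling takes one available colour, so the
      -- case of no colours is decided separately.
      Matrix : Set
      Matrix = Vec (Vec (Fin (suc c)) n) n

      entry : Matrix → Fin n → Fin n → Fin (suc c)
      entry m u v = Vec.lookup (Vec.lookup m u) v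

      Symmetric : Matrix → Set
      Symmetric m = ∀ u v → entry m u v ≡ entry m v u

      fromMatrix : ∀ m → Symmetric m → EdgeColouring G (suc c)
      fromMatrix m s = record { colour = λ {u} {v} _ → entry m u v ; undirected = λ _ _ → s _ _ }

      module _ (f : EdgeColouring G (suc c)) where

        value : ∀ u v → Dec (Adj G u v) → Fin (suc c)
        value u v (yes e) = colour f e
        value u v (no _)  = zero

        toMatrix : Matrix
        toMatrix = Vec.tabulate λ u → Vec.tabulate λ v → value u v (T? (adj G u v))

        entry-toMatrix : ∀ u v → entry toMatrix u v ≡ value u v (T? (adj G u v))
        entry-toMatrix u v = trans (cong (λ row → Vec.lookup row v) (Vec.lookup∘tabulate _ u)) (Vec.lookup∘tabulate _ v)

        value-edge : ∀ {u v} (e : Adj G u v) d → value u v d ≡ colour f e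
        value-edge e (yes e′) = cong (colour f) (Bool.T-irrelevant e′ e)
        value-edge e (no ¬e)  = ⊥-elim (¬e e)

        value-sym : ∀ u v d d′ → value u v d ≡ value v u d′
        value-sym u v (yes e) (yes e′) = undirected f e e′
        value-sym u v (yes e) (no ¬e)  = ⊥-elim (¬e (Adj-sym G e))
        value-sym u v (no ¬e) (yes e)  = ⊥-elim (¬e (Adj-sym G e))
        value-sym u v (no _)  (no _)   = refl

    colourable-suc? : Dec (ConflictFreeColourable G (suc c))
    colourable-suc? = map′
      (λ (m , s , cfc) → fromMatrix m s , cfc)
      (λ (f , cfc) → toMatrix f ,
        (λ u v → trans (entry-toMatrix f u v) (trans (value-sym f u v (T? _) (T? _)) (sym (entry-toMatrix f v u)))) ,
        conflictFreeConnected-agree f _ (λ {u} {v} e → sym (trans (entry-toMatrix f u v) (value-edge f e (T? _)))) cfc)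
      (search-Vec (search-Vec any? n) n λ m → symmetric-any? m)
      where
      symmetric-any? : ∀ m → Dec (Σ[ s ∈ Symmetric m ] ConflictFreeConnected (fromMatrix m s))
      symmetric-any? m with all? (λ u → all? λ v → entry m u v ≟ entry m v u)
      ... | no ¬s = no (¬s ∘ proj₁)
      ... | yes s = map′ (s ,_)
        (λ (s′ , cfc) → conflictFreeConnected-agree (fromMatrix m s′) (fromMatrix m s) (λ _ → refl) cfc)
        (conflictFreeConnected? (fromMatrix m s))

  colourable? : Decidable (ConflictFreeColourable G)
  colourable? (suc c) = colourable-suc? c
  colourable? zero with any? (λ u → any? λ v → ¬? (u ≟ v))
  ... | yes (u , v , u≢v) = no λ (f , cfc) → case proj₁ (proj₂ (proj₂ (cfc u v u≢v))) of λ ()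
  ... | no trivial = yes
    (record { colour = λ e → ⊥-elim (edgeless e) ; undirected = λ e _ → ⊥-elim (edgeless e) } ,
     λ u v u≢v → ⊥-elim (trivial (u , v , u≢v)))
    where
    edgeless : ∀ {u v} → ¬ Adj G u v
    edgeless {u} {v} e = trivial (u , v , λ { refl → loopless G u e })

  -- The number cfc is a least element, which a colouring with k colours yields constructively only
  -- because all smaller numbers can be tested.
  colourable⇒cfc≤ : ∀ {k} → ConflictFreeColourable G k → ∃[ c ] IsCfc G c × c ≤ k
  colourable⇒cfc≤ {k} col = let c , is , min = least colourable? k col in c , (is , min) , min k col

-- Counting degrees at the components

injection-length : ∀ {A B : Set} (R : A → B → Set) {xs ys} → Unique xs →
                   (∀ {x} → x ∈ xs → ∃[ y ] y ∈ ys × R x y) →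
                   (∀ {x x′ y} → R x y → R x′ y → x ≡ x′) → length xs ≤ length ys
injection-length R [] _ _ = z≤n
injection-length R {x ∷ xs} (x∉xs ∷ u) total inj with total (here refl)
... | y , y∈ys , Rxy with ∈⇒↭ y∈ys
... | ys′ , perm = ≤-trans (s≤s (injection-length R u total′ inj)) (≤-reflexive (sym (Perm.↭-length perm)))
  where
  total′ : ∀ {x′} → x′ ∈ xs → ∃[ y′ ] y′ ∈ ys′ × R x′ y′
  total′ x′∈ with total (there x′∈)
  ... | y′ , y′∈ys , Rx′y′ with Perm.∈-resp-↭ perm y′∈ys
  ... | here refl = ⊥-elim (All.lookup x∉xs x′∈ (inj Rxy Rx′y′))
  ... | there y′∈ = y′ , y′∈ , Rx′y′

short⇒equal : ∀ {A : Set} {xs : List A} {x y} → length xs ≤ 1 → x ∈ xs → y ∈ xs → x ≡ y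
short⇒equal {xs = _ ∷ []} _ (here refl) (here refl) = refl
short⇒equal {xs = _ ∷ _ ∷ _} (s≤s ()) _ _

two-distinct : ∀ {A : Set} {xs : List A} → Unique xs → 2 ≤ length xs → ∃[ x ] ∃[ y ] x ∈ xs × y ∈ xs × x ≢ y
two-distinct {xs = x ∷ y ∷ _} ((x≢y ∷ _) ∷ _) _ = x , y , here refl , there (here refl) , x≢y
two-distinct {xs = _ ∷ []} _ (s≤s ())

module _ {n} {G : Graph n} {r : Fin n} (tree : SpanningTree G r) where
  open Rooted tree

  unmatcheds : List (Fin n)
  unmatcheds = filter unmatched? (allFin n)

  ∈unmatcheds⁺ : ∀ {c} → Unmatched c → c ∈ unmatcheds
  ∈unmatcheds⁺ = ∈-filter⁺ unmatched? (∈-allFin _)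

  ∈unmatcheds⁻ : ∀ {c} → c ∈ unmatcheds → Unmatched c
  ∈unmatcheds⁻ = proj₂ ∘ ∈-filter⁻ unmatched? {xs = allFin n}

  unmatcheds-unique : Unique unmatcheds
  unmatcheds-unique = Unique.filter⁺ unmatched? (Unique.allFin⁺ n)

  unmatcheds-independent : IndependentList G unmatcheds
  unmatcheds-independent c∈ d∈ = unmatched-independent (∈unmatcheds⁻ c∈) (∈unmatcheds⁻ d∈)

  -- There is one component more than there are bridges, the extra one being that of r, and `mateOf`
  -- pairs the matched components with the bridges of the matching. Cancelling these pairs leaves
  -- the claim.
  nonMates<unmatcheds : suc (length (nonMates tree)) ≤ length unmatcheds
  nonMates<unmatcheds = ℕ.+-cancelʳ-≤ (length matcheds) _ _ (begin
    suc (length (nonMates tree)) + length matcheds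
      ≡⟨ cong (suc (length (nonMates tree)) +_) (length-map (mateOf tree) matcheds) ⟨
    suc (length (nonMates tree)) + length (map (mateOf tree) matcheds)
      ≡⟨ cong suc (length-++ (nonMates tree)) ⟨
    length (r ∷ nonMates tree ++ map (mateOf tree) matcheds)
      ≤⟨ Unique-⊆-length all-unique all-⊆ ⟩
    length (unmatcheds ++ matcheds)
      ≡⟨ length-++ unmatcheds ⟩
    length unmatcheds + length matcheds ∎)
    where
    open ≤-Reasoning
    MatchedTop : Fin n → Set
    MatchedTop c = IsTop c × Matched c
    matchedTop? : Decidable MatchedTop
    matchedTop? c = isTop? c ×-dec matched? c
    matcheds = filter matchedTop? (allFin n)
    matched∈ : ∀ {c} → c ∈ matcheds → Child c (mateOf tree c)
    matched∈ c∈ = proj₁ (mateOf-matched tree (proj₂ (proj₂ (∈-filter⁻ matchedTop? {xs = allFin n} c∈))))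
    isBridge : ∀ {x} → x ∈ nonMates tree ++ map (mateOf tree) matcheds → Bridge x
    isBridge x∈ = [ ∈nonMates⁻ tree , (λ x∈ → let c , c∈ , eq = ∈-map⁻ (mateOf tree) x∈ in
      subst Bridge (sym eq) (proj₁ (matched∈ c∈))) ]′ (∈-++⁻ (nonMates tree) x∈)
    all-unique : Unique (r ∷ nonMates tree ++ map (mateOf tree) matcheds)
    all-unique = All.tabulate (λ x∈ r≡x → proj₁ (isBridge x∈) (sym r≡x)) ∷
      Unique.++⁺ (nonMates-unique tree)
        (Unique-map (mateOf tree) (Unique.filter⁺ matchedTop? (Unique.allFin⁺ n)) λ c∈ d∈ eq →
          trans (sym (proj₂ (matched∈ c∈))) (trans (cong (top ∘ p) eq) (proj₂ (matched∈ d∈))))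
        λ (x∈ , x∈′) → let c , c∈ , eq = ∈-map⁻ (mateOf tree) x∈′ in
          ∈nonMates⇒¬Mate tree x∈ (isBridge (∈-++⁺ˡ x∈) ,
            subst (λ x → mateOf tree (top (p x)) ≡ x) (sym eq) (cong (mateOf tree) (proj₂ (matched∈ c∈))))
    isTop : ∀ {x} → x ∈ r ∷ nonMates tree ++ map (mateOf tree) matcheds → IsTop x
    isTop (here refl) = inj₁ refl
    isTop (there x∈)  = inj₂ (isBridge x∈)
    all-⊆ : r ∷ nonMates tree ++ map (mateOf tree) matcheds ⊆ unmatcheds ++ matcheds
    all-⊆ {x} x∈ with matched? x
    ... | yes m = ∈-++⁺ʳ unmatcheds (∈-filter⁺ matchedTop? (∈-allFin x) (isTop x∈ , m))
    ... | no ¬m = ∈-++⁺ˡ (∈unmatcheds⁺ (isTop x∈ , ¬m))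

  -- Charge the edge from c to its parent to c itself, and every other edge at c to its
  -- other end: each vertex is charged at most once, and the root never.
  unmatcheds-degree : totalDegree G unmatcheds < n
  unmatcheds-degree = begin-strict
    totalDegree G unmatcheds
      ≡⟨ cong sum (map-cong (λ c → trans (degree≡length G c) (sym (length-map (charge c) (neighbours G c)))) unmatcheds) ⟩
    sum (map (length ∘ charged) unmatcheds)
      ≡⟨ length-concatMap charged unmatcheds ⟨
    length (concatMap charged unmatcheds)
      <⟨ Unique-⊆-length (All.tabulate r∉ ∷ unique) (λ {x} _ → ∈-allFin x) ⟩
    length (allFin n)
      ≡⟨ length-tabulate id ⟩
    n ∎
    where
    open ≤-Reasoning
    charge : Fin n → Fin n → Fin n
    charge c w with w ≟ p c
    ... | yes _ = c
    ... | no _  = w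
    charged : Fin n → List (Fin n)
    charged c = map (charge c) (neighbours G c)
    Owns : Fin n → Fin n → Set
    Owns c z = z ≢ r × (top z ≡ c ⊎ Child c z)
    owns : ∀ {c w} → Unmatched c → Adj G c w → Owns c (charge c w)
    owns {c} {w} (tc , _) e with w ≟ p c
    -- The root has no parent edge: `p r` is `r`, so at the root this branch would give a loop.
    ... | yes refl = (λ { refl → loopless G r (subst (Adj G r) p-r e) }) , inj₁ (top-isTop tc)
    ... | no w≢pc with top w ≟ c
    ... | yes eq = (λ { refl → loopless G r (subst (λ c → Adj G c r) (trans (sym eq) (top-isTop (inj₁ refl))) e) }) , inj₁ eq
    ... | no neq with top-edge e (λ eq → neq (trans (sym eq) (top-isTop tc)))
    ... | inj₁ (_ , eq)  = ⊥-elim (w≢pc (sym eq))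
    ... | inj₂ (bw , eq) = proj₁ bw , inj₂ (bw , trans (cong top eq) (top-isTop tc))
    owner-unique : ∀ {c d z} → Unmatched c → Unmatched d → Owns c z → Owns d z → c ≡ d
    owner-unique _ _ (_ , inj₁ refl) (_ , inj₁ eq) = eq
    owner-unique (_ , ¬mc) (_ , ¬md) (_ , inj₁ refl) (_ , inj₂ (bz , eq)) =
      ⊥-elim (¬md (matched⁺ (bz , eq) (subst (¬_ ∘ Matched) (top-bridge bz) ¬mc)))
    owner-unique (_ , ¬mc) (_ , ¬md) (_ , inj₂ (bz , eq)) (_ , inj₁ refl) =
      ⊥-elim (¬mc (matched⁺ (bz , eq) (subst (¬_ ∘ Matched) (top-bridge bz) ¬md)))
    owner-unique _ _ (_ , inj₂ (_ , refl)) (_ , inj₂ (_ , eq)) = eq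
    charge-injective : ∀ {c w w′} → Adj G c w → Adj G c w′ → charge c w ≡ charge c w′ → w ≡ w′
    charge-injective {c} {w} {w′} e e′ eq with w ≟ p c | w′ ≟ p c
    ... | yes a | yes b = trans a (sym b)
    ... | yes _ | no _  = ⊥-elim (loopless G c (subst (Adj G c) (sym eq) e′))
    ... | no _  | yes _ = ⊥-elim (loopless G c (subst (Adj G c) eq e))
    ... | no _  | no _  = eq
    owned : ∀ {c z} → c ∈ unmatcheds → z ∈ charged c → Owns c z
    owned c∈ z∈ = let w , w∈ , eq = ∈-map⁻ (charge _) z∈ in
      subst (Owns _) (sym eq) (owns (∈unmatcheds⁻ c∈) (∈-neighbours⁻ G w∈))
    unique : Unique (concatMap charged unmatcheds)
    unique = Unique-concatMap charged unmatcheds-unique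
      (λ {c} _ → Unique-map (charge c) (neighbours-unique G c)
        λ w∈ w′∈ → charge-injective (∈-neighbours⁻ G w∈) (∈-neighbours⁻ G w′∈))
      λ c∈ d∈ z∈ z∈′ → owner-unique (∈unmatcheds⁻ c∈) (∈unmatcheds⁻ d∈) (owned c∈ z∈) (owned d∈ z∈′)
    r∉ : ∀ {z} → z ∈ concatMap charged unmatcheds → r ≢ z
    r∉ z∈ r≡z = let c , c∈ , z∈c = find (∈-concatMap⁻ charged z∈) in proj₁ (owned c∈ z∈c) (sym r≡z)

  -- The only edge at v is its parent edge, hence a bridge, and nothing hangs below v that could be
  -- its mate. So lower bounds on the degrees of unmatched vertices reach all vertices other than
  -- the root.
  leaf-unmatched : ∀ {v} → v ≢ r → degree G v ≤ 1 → Unmatched v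
  leaf-unmatched {v} v≢r d≤1 = inj₂ bridge , λ m → let x , (bx , eq) , _ = mate v m in
    childless (up (proj₁ bx) (subst (p x ⊑_) eq (⊑-top (p x))))
      (λ x≡v → n≮n _ (subst (λ z → depth v < depth z) x≡v (child-depth (bx , eq))))
    where
    only : ∀ {w} → Adj G v w → w ≡ p v
    only e = short⇒equal (subst (_≤ 1) (degree≡length G v) d≤1) (∈-neighbours⁺ G e) (∈-neighbours⁺ G (p-adj v≢r))
    childless : ∀ {a} → a ⊑ v → a ≢ v → ⊥
    childless here a≢v = a≢v refl
    childless (up {a} a≢r q) _ with p a ≟ v
    ... | no pa≢v  = childless q pa≢v
    ... | yes refl = ℕ.<-asym (p< a≢r) (subst (λ w → depth w < depth (p a)) (sym (only (Adj-sym G (p-adj a≢r)))) (p< v≢r))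
    bridge : Bridge v
    bridge = v≢r , λ a b e a⊑v b⋢v → case a ≟ v of λ
      { (yes refl) → refl , only e ; (no a≢v) → ⊥-elim (childless a⊑v a≢v) }

-- Components with and without interior vertices

module _ {n} {G : Graph n} {r : Fin n} (tree : SpanningTree G r) where
  open Rooted tree

  Interior : Fin n → Set
  Interior v = ∀ x → Bridge x → v ≢ x × v ≢ p x

  Good : Fin n → Set
  Good c = ∃[ w ] Interior w × top w ≡ c

  abstract
    good? : Decidable Good
    good? c = any? λ w → (all? λ x → bridge? x →-dec (¬? (w ≟ x) ×-dec ¬? (w ≟ p x))) ×-dec top w ≟ c

  interior-top : ∀ {v w} → Interior v → Adj G v w → top w ≡ top v
  interior-top {v} {w} int e = decidable-stable (top w ≟ top v) λ neq → case top-edge e (neq ∘ sym) of λ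
    { (inj₁ (bv , _))  → proj₁ (int v bv) refl
    ; (inj₂ (bw , eq)) → proj₂ (int w bw) (sym eq) }

  goods : List (Fin n)
  goods = filter good? (allFin n)

  ∈goods⁺ : ∀ {c} → Good c → c ∈ goods
  ∈goods⁺ = ∈-filter⁺ good? (∈-allFin _)

  ∈goods⁻ : ∀ {c} → c ∈ goods → Good c
  ∈goods⁻ = proj₂ ∘ ∈-filter⁻ good? {xs = allFin n}

  goods-unique : Unique goods
  goods-unique = Unique.filter⁺ good? (Unique.allFin⁺ n)

  interior : Fin n → Fin n
  interior c with good? c
  ... | yes (w , _) = w
  ... | no _        = c

  interior-good : ∀ {c} → Good c → Interior (interior c) × top (interior c) ≡ c
  interior-good {c} g with good? c
  ... | yes (_ , q) = q
  ... | no ¬g       = ⊥-elim (¬g g)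

  -- The closed neighbourhoods of interior vertices of distinct components are disjoint
  -- from each other and from the components without interior vertices.
  module _ {bs : List (Fin n)} (bs-unique : Unique bs) (bs-bad : ∀ {b} → b ∈ bs → ¬ Good (top b)) where

    goods-degree : weight (degree G ∘ interior) goods + length goods + length bs ≤ n
    goods-degree = begin
      weight (degree G ∘ interior) goods + length goods + length bs ≡⟨ cong (_+ length bs) (sum-suc goods) ⟨
      sum (map (length ∘ closed) goods) + length bs                 ≡⟨ cong (_+ length bs) (length-concatMap closed goods) ⟨
      length (concatMap closed goods) + length bs                   ≡⟨ length-++ (concatMap closed goods) ⟨
      length (concatMap closed goods ++ bs)                         ≤⟨ Unique-⊆-length all-unique (λ {x} _ → ∈-allFin x) ⟩
      length (allFin n)                                             ≡⟨ length-tabulate id ⟩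
      n                                                             ∎
      where
      open ≤-Reasoning
      closed : Fin n → List (Fin n)
      closed c = interior c ∷ neighbours G (interior c)
      sum-suc : ∀ xs → sum (map (length ∘ closed) xs) ≡ weight (degree G ∘ interior) xs + length xs
      sum-suc []       = refl
      sum-suc (x ∷ xs) rewrite sum-suc xs | degree≡length G (interior x) = arith (length (neighbours G (interior x))) _ _
        where arith : ∀ a b c → suc a + (b + c) ≡ a + b + suc c
              arith = solve-∀
      closed-top : ∀ {c z} → c ∈ goods → z ∈ closed c → top z ≡ c
      closed-top c∈ (here refl) = proj₂ (interior-good (∈goods⁻ c∈))
      closed-top c∈ (there z∈)  = let int , eq = interior-good (∈goods⁻ c∈) in
        trans (interior-top int (∈-neighbours⁻ G z∈)) eq
      all-unique : Unique (concatMap closed goods ++ bs)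
      all-unique = Unique.++⁺
        (Unique-concatMap closed goods-unique
          (λ {c} _ → All.tabulate (λ { w∈ refl → loopless G _ (∈-neighbours⁻ G w∈) }) ∷ neighbours-unique G (interior c))
          λ c∈ d∈ z∈ z∈′ → trans (sym (closed-top c∈ z∈)) (closed-top d∈ z∈′))
        bs-unique
        λ (z∈ , z∈bs) → let c , c∈ , z∈c = find (∈-concatMap⁻ closed z∈) in
          bs-bad z∈bs (subst Good (sym (closed-top c∈ z∈c)) (∈goods⁻ c∈))

    module _ (bs-independent : IndependentList G bs) {cs} (cs-unique : Unique cs) (cs⊆ : cs ⊆ goods) where

      chosen : List (Fin n)
      chosen = bs ++ map interior cs

      chosen-unique : Unique chosen
      chosen-unique = Unique.++⁺ bs-unique
        (Unique-map interior cs-unique λ c∈ d∈ eq →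
          trans (sym (proj₂ (interior-good (∈goods⁻ (cs⊆ c∈)))))
            (trans (cong top eq) (proj₂ (interior-good (∈goods⁻ (cs⊆ d∈))))))
        λ (z∈bs , z∈) → let c , c∈ , eq = ∈-map⁻ interior z∈ ; g = ∈goods⁻ (cs⊆ c∈) in
          bs-bad z∈bs (subst Good (trans (sym (proj₂ (interior-good g))) (cong top (sym eq))) g)

      chosen-independent : IndependentList G chosen
      chosen-independent {x} {y} x∈ y∈ e =
        [ (λ x∈ → [ (λ y∈ → bs-independent x∈ y∈ e) , (λ y∈ → mixed x∈ y∈ e) ]′ (∈-++⁻ bs y∈))
        , (λ x∈ → [ (λ y∈ → mixed y∈ x∈ (Adj-sym G e)) , (λ y∈ → interiors x∈ y∈ e) ]′ (∈-++⁻ bs y∈)) ]′ (∈-++⁻ bs x∈)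
        where
        located : ∀ {x} → x ∈ map interior cs → ∃[ c ] x ≡ interior c × Good c × Interior x × top x ≡ c
        located x∈ with ∈-map⁻ interior x∈
        ... | c , c∈ , refl = c , refl , ∈goods⁻ (cs⊆ c∈) , interior-good (∈goods⁻ (cs⊆ c∈))
        mixed : ∀ {x y} → x ∈ bs → y ∈ map interior cs → ¬ Adj G x y
        mixed x∈ y∈ e = let _ , _ , g , int , eq = located y∈ in
          bs-bad x∈ (subst Good (sym (trans (interior-top int (Adj-sym G e)) eq)) g)
        interiors : ∀ {x y} → x ∈ map interior cs → y ∈ map interior cs → ¬ Adj G x y
        interiors {x} x∈ y∈ e =
          let c , x≡ , _ , int , eq = located x∈ ; d , y≡ , _ , _ , eq′ = located y∈
          in loopless G x (subst (Adj G x)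
               (trans y≡ (trans (cong interior (trans (sym eq′) (trans (interior-top int e) eq))) (sym x≡))) e)

  module _ (δ≥2 : ∀ v → 2 ≤ degree G v) (r-max : ∀ v → degree G v ≤ degree G r) where

    -- At a lowest bridge below x the component is a leaf of the bridge tree. Since its topmost
    -- vertex has degree at least 2, it has a neighbour other than its parent, and no further bridge
    -- is there to touch that neighbour.
    good-below : ∀ {x} → Bridge x → ∃[ c ] Good c × c ⊑ x
    good-below {x} bx = go (proj₁ B) bx (ℕ.m≤n+m _ _)
      where
      B = Fin-bounded depth
      go : ∀ m {x} → Bridge x → proj₁ B ≤ depth x + m → ∃[ c ] Good c × c ⊑ x
      go m {x} bx le with any? (λ y → bridge? y ×-dec (y ⊑? x ×-dec ¬? (y ≟ x)))
      go zero {x} bx le | yes (y , _ , y⊑x , y≢x) =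
        ⊥-elim (y≢x (⊑-depth-≡ y⊑x (≤-trans (proj₂ B y) (≤-trans le (≤-reflexive (ℕ.+-identityʳ _))))))
      go (suc m) {x} bx le | yes (y , by , y⊑x , y≢x) =
        let c , g , c⊑y = go m by (≤-trans le (≤-trans (≤-reflexive (ℕ.+-suc _ m))
                            (ℕ.+-monoˡ-≤ m (ℕ.≰⇒> λ dy≤dx → y≢x (⊑-depth-≡ y⊑x dy≤dx)))))
        in c , g , ⊑-trans c⊑y y⊑x
      ... | no lowest = case w ≟ p x of λ
          { (no w≢px) → from (∈-neighbours⁻ G w∈) w≢px
          ; (yes w≡px) → from (∈-neighbours⁻ G w′∈) λ w′≡px → w≢w′ (trans w≡px (sym w′≡px)) }
        where
        two = two-distinct (neighbours-unique G x) (subst (2 ≤_) (degree≡length G x) (δ≥2 x))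
        w    = proj₁ two
        w′   = proj₁ (proj₂ two)
        w∈   = proj₁ (proj₂ (proj₂ two))
        w′∈  = proj₁ (proj₂ (proj₂ (proj₂ two)))
        w≢w′ = proj₂ (proj₂ (proj₂ (proj₂ two)))
        from : ∀ {w} → Adj G x w → w ≢ p x → ∃[ c ] Good c × c ⊑ x
        from {w} e w≢px = top w , (w , int , refl) , top-least bx w⊑x
          where
          w⊑x : w ⊑ x
          w⊑x = decidable-stable (w ⊑? x) λ w⋢x → w≢px (proj₂ (proj₂ bx _ _ e here w⋢x))
          w≢x : w ≢ x
          w≢x refl = loopless G w e
          int : Interior w
          int y by = (λ { refl → lowest (w , by , w⊑x , w≢x) }) ,
                     λ { refl → lowest (y , by , up (proj₁ by) w⊑x , λ { refl → p⋢ (proj₁ by) w⊑x }) }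

    -- In a component c without interior vertices, a neighbour w of a vertex v is recovered
    -- from a bridge x leaving c: the edge vw is that bridge, or w is its end in c.
    far-end : Fin n → Fin n → Fin n → Fin n
    far-end c v x with x ≟ c | v ≟ c | p x ≟ v
    ... | yes _ | yes _ | _     = p v
    ... | yes _ | no _  | _     = c
    ... | no _  | _     | yes _ = x
    ... | no _  | _     | no _  = p x

    Leaves : Fin n → Fin n → Set
    Leaves c x = Bridge x × (x ≡ c ⊎ Child c x)

    leaving-bridge : ∀ {v w} → ¬ Good (top v) → Adj G v w →
                     ∃[ x ] Leaves (top v) x × w ≡ far-end (top v) v x
    leaving-bridge {v} {w} bad e with top w ≟ top v
    ... | no neq with top-edge e (neq ∘ sym)
    ... | inj₁ (bv , refl) = v , (bv , inj₁ (sym (top-bridge bv))) , eq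
      where
      eq : p v ≡ far-end (top v) v v
      eq with v ≟ top v | p v ≟ v
      ... | yes _ | _ = refl
      ... | no v≢ | _ = ⊥-elim (v≢ (sym (top-bridge bv)))
    ... | inj₂ (bw , refl) = w , (bw , inj₂ (bw , refl)) , eq
      where
      eq : w ≡ far-end (top (p w)) (p w) w
      eq with w ≟ top (p w) | p w ≟ top (p w) | p w ≟ p w
      ... | yes w≡ | _ | _     = ⊥-elim (neq (trans (top-bridge bw) w≡))
      ... | no _   | _ | yes _ = refl
      ... | no _   | _ | no ≢  = ⊥-elim (≢ refl)
    leaving-bridge {v} {w} bad e | yes same with any? (λ x → bridge? x ×-dec (w ≟ x ⊎-dec w ≟ p x))
    ... | no none = ⊥-elim (bad (w , (λ x bx → (λ eq → none (x , bx , inj₁ eq)) , λ eq → none (x , bx , inj₂ eq)) , same))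
    ... | yes (.w , bw , inj₁ refl) = w , (bw , inj₁ (trans (sym (top-bridge bw)) same)) , eq
      where
      w≡ : w ≡ top v
      w≡ = trans (sym (top-bridge bw)) same
      eq : w ≡ far-end (top v) v w
      eq with w ≟ top v | v ≟ top v | p w ≟ v
      ... | no w≢ | _      | _ = ⊥-elim (w≢ w≡)
      ... | yes _ | yes v≡ | _ = ⊥-elim (loopless G w (subst (λ x → Adj G x w) (trans v≡ (sym w≡)) e))
      ... | yes _ | no _   | _ = w≡
    ... | yes (x , bx , inj₂ refl) = x , (bx , inj₂ (bx , same)) , eq
      where
      eq : p x ≡ far-end (top v) v x
      eq with x ≟ top v | v ≟ top v | p x ≟ v
      ... | yes x≡ | _ | _        = ⊥-elim (n≮n _ (subst (λ c → depth c < depth x) (sym x≡) (child-depth (bx , same))))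
      ... | no _   | _ | yes refl = ⊥-elim (loopless G v e)
      ... | no _   | _ | no _     = refl

    private
      bad-degree′ : ∀ {v} → ¬ Good (top v) → Good r ⊎ top v ≡ r → degree G v ≤ length goods
      bad-degree′ {v} bad case-r = ≤-trans (≤-reflexive (degree≡length G v))
        (injection-length Reaches (neighbours-unique G v) (reaches ∘ ∈-neighbours⁻ G) reaches-injective)
        where
        Via : Fin n → Fin n → Set
        Via c x = (x ≡ top v × c ≡ r) ⊎ (Child (top v) x × c ⊑ x)
        Reaches : Fin n → Fin n → Set
        Reaches w c = ∃[ x ] Bridge x × Via c x × w ≡ far-end (top v) v x
        reaches : ∀ {w} → Adj G v w → ∃[ c ] c ∈ goods × Reaches w c
        reaches e with leaving-bridge bad e
        ... | x , (bx , inj₂ cx) , eq = let c , g , c⊑x = good-below bx in c , ∈goods⁺ g , x , bx , inj₂ (cx , c⊑x) , eq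
        ... | x , (bx , inj₁ x≡) , eq = r , ∈goods⁺ g , x , bx , inj₁ (x≡ , refl) , eq
          where
          g : Good r
          g = [ id , (λ top≡r → ⊥-elim (proj₁ bx (trans x≡ top≡r))) ]′ case-r
        via-unique : ∀ {c x y} → Bridge x → Bridge y → Via c x → Via c y → x ≡ y
        via-unique _ _ (inj₁ (a , _)) (inj₁ (b , _)) = trans a (sym b)
        via-unique _ by (inj₁ (_ , refl)) (inj₂ (_ , r⊑y)) = ⊥-elim (proj₁ by (r⊑⇒≡ r⊑y))
        via-unique bx _ (inj₂ (_ , r⊑x)) (inj₁ (_ , refl)) = ⊥-elim (proj₁ bx (r⊑⇒≡ r⊑x))
        via-unique _ _ (inj₂ (cx , q)) (inj₂ (cy , q′)) = children-disjoint cx cy q q′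
        reaches-injective : ∀ {w w′ c} → Reaches w c → Reaches w′ c → w ≡ w′
        reaches-injective (x , bx , q , eq) (y , by , q′ , eq′) =
          trans eq (trans (cong (far-end (top v) v) (via-unique bx by q q′)) (sym eq′))

    -- The subtrees at distinct bridges leaving the component of v hold distinct good
    -- components.  The bridge towards the root gives the root's component; if that one
    -- has no interior vertex, the maximality of deg r reduces the claim to v = r.
    bad-degree : ∀ {v} → ¬ Good (top v) → degree G v ≤ length goods
    bad-degree {v} bad with good? r
    ... | yes g = bad-degree′ bad (inj₁ g)
    ... | no ¬g = ≤-trans (r-max v) (bad-degree′ (subst (¬_ ∘ Good) (sym top-r) ¬g) (inj₂ top-r))
      where
      top-r : top r ≡ r
      top-r = top-isTop (inj₁ refl)

    module _ {c} (c-unmatched : Unmatched c) (c-bad : ¬ Good c) where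

      private
        tc = proj₁ c-unmatched
        ¬mc = proj₂ c-unmatched
        top-c : top c ≡ c
        top-c = top-isTop tc

        Across : Fin n → Fin n → Set
        Across x q = (x ≡ c × Bridge c × q ≡ top (p c)) ⊎ (Child c x × q ≡ x)

        across-isTop : ∀ {x q} → Across x q → IsTop q × Matched q
        across-isTop (inj₁ (refl , bc , refl)) = isTop-top _ , matched⁺ (bc , refl) ¬mc
        across-isTop (inj₂ (cx , refl)) = inj₂ (proj₁ cx) ,
          decidable-stable (matched? _) λ ¬mx → ¬mc (matched⁺ cx ¬mx)

        across-nonadjacent : ∀ {x y q s} → x ≢ y → Across x q → Across y s → ¬ Child q s × q ≢ s
        across-nonadjacent x≢y (inj₁ (refl , _)) (inj₁ (refl , _)) = ⊥-elim (x≢y refl)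
        across-nonadjacent x≢y (inj₁ (_ , bc , refl)) (inj₂ (cy , refl)) =
          (λ ch → n≮n _ (subst (λ q → depth q < depth c) (trans (sym (proj₂ ch)) (proj₂ cy)) (child-depth (bc , refl)))) ,
          λ eq → ℕ.<-asym (child-depth cy) (subst (λ q → depth q < depth c) eq (child-depth (bc , refl)))
        across-nonadjacent x≢y (inj₂ (cx , refl)) (inj₁ (_ , bc , refl)) =
          (λ ch → ℕ.<-asym (child-depth cx) (ℕ.<-trans (child-depth ch) (child-depth (bc , refl)))) ,
          λ eq → ℕ.<-asym (child-depth cx) (subst (λ q → depth q < depth c) (sym eq) (child-depth (bc , refl)))
        across-nonadjacent x≢y (inj₂ (cx , refl)) (inj₂ (cy , refl)) =
          (λ ch → n≮n _ (subst (λ q → depth c < depth q) (trans (sym (proj₂ ch)) (proj₂ cy)) (child-depth cx))) , x≢y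

        leaving : ∀ {w} → Adj G c w → ∃[ x ] ∃[ q ] Across x q × w ≡ far-end c c x
        leaving e with leaving-bridge (subst (¬_ ∘ Good) (sym top-c) c-bad) e
        ... | x , (bx , inj₁ x≡) , eq = x , top (p c) ,
                inj₁ (trans x≡ top-c , subst Bridge (trans x≡ top-c) bx , refl) ,
                trans eq (cong (λ t → far-end t c x) top-c)
        ... | x , (bx , inj₂ cx) , eq = x , x , inj₂ (subst (λ t → Child t x) top-c cx , refl) ,
                trans eq (cong (λ t → far-end t c x) top-c)

      -- The vertex c has two neighbours and, its component being bad, a different bridge leaves for
      -- each. The components across are matched because c is not, and two neighbours of one node of
      -- a tree are not adjacent.
      two-across : ∃[ q ] ∃[ s ] (IsTop q × Matched q) × (IsTop s × Matched s) × q ≢ s × ¬ Adj G q s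
      two-across with two-distinct (neighbours-unique G c) (subst (2 ≤_) (degree≡length G c) (δ≥2 c))
      ... | w , w′ , w∈ , w′∈ , w≢w′ with leaving (∈-neighbours⁻ G w∈) | leaving (∈-neighbours⁻ G w′∈)
      ... | x , q , aq , eq | y , s , as , eq′ =
        q , s , across-isTop aq , across-isTop as , q≢s , λ e →
          case top-edge e (λ t → q≢s (trans (sym (top-isTop tq)) (trans t (top-isTop ts)))) of λ
            { (inj₁ (bq , e)) → proj₁ (across-nonadjacent (x≢y ∘ sym) as aq) (bq , trans (cong top e) (top-isTop ts))
            ; (inj₂ (bs , e)) → proj₁ (across-nonadjacent x≢y aq as) (bs , trans (cong top e) (top-isTop tq)) }
        where
        x≢y : x ≢ y
        x≢y refl = w≢w′ (trans eq (sym eq′))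
        q≢s = proj₂ (across-nonadjacent x≢y aq as)
        tq = proj₁ (across-isTop aq)
        ts = proj₁ (across-isTop as)

-- Holds is the lower bound that σ₄ imposes on the degree sum of four independent vertices.
module Selection {n} {G : Graph n} {r : Fin n} (tree : SpanningTree G r)
         (Holds : ℕ → Set)
         (σ₄-holds : ∀ xs → Unique xs → length xs ≡ 4 → IndependentList G xs → Holds (totalDegree G xs)) where
  open Rooted tree

  private
    i = length (unmatcheds tree)
    g = length (goods tree)

  sublist-unique : ∀ {A : Set} {xs ys zs : List A} → Unique xs → xs ↭ ys ++ zs → Unique ys
  sublist-unique {ys = []}     u perm = []
  sublist-unique {ys = y ∷ ys} u perm with Unique-resp-↭ perm u
  ... | y∉ ∷ u′ = All.++⁻ˡ ys y∉ ∷ sublist-unique u′ ↭-refl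

  sublist-⊆ : ∀ {A : Set} {xs ys zs : List A} → xs ↭ ys ++ zs → ys ⊆ xs
  sublist-⊆ perm y∈ = Perm.∈-resp-↭ (↭-sym perm) (∈-++⁺ˡ y∈)

  lightest-unmatcheds : 4 ≤ i → ∃[ y ] ∃[ Y ] Holds y × i * y ≤ 4 * Y × Y < n
  lightest-unmatcheds 4≤i with lightest (degree G) 4 (unmatcheds tree) 4≤i
  ... | ys , zs , perm , len , avg = totalDegree G ys , totalDegree G (unmatcheds tree) ,
        σ₄-holds ys (sublist-unique (unmatcheds-unique tree) perm) len
          (λ x∈ y∈ → unmatcheds-independent tree (sublist-⊆ perm x∈) (sublist-⊆ perm y∈)) ,
        avg , unmatcheds-degree tree

  -- Used to bound the degree of x from below: three of the m others take at most the fraction 3/m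
  -- of what x leaves of n, so x has to make up the rest of the σ₄ bound.
  lightest-with : ∀ {x m} → x ∈ unmatcheds tree → suc m ≤ i → 3 ≤ m →
                  ∃[ y ] ∃[ Y ] Holds (degree G x + y) × m * y ≤ 3 * Y × degree G x + Y < n
  lightest-with {x} {m} x∈ m<i 3≤m with ∈⇒↭ x∈
  ... | xs , perm with lightest (degree G) 3 xs (≤-trans 3≤m m≤) 
    where m≤ = ℕ.≤-pred (≤-trans m<i (≤-reflexive (Perm.↭-length perm)))
  ... | ys , zs , perm′ , len , avg = totalDegree G ys , totalDegree G xs ,
        σ₄-holds (x ∷ ys) (sublist-unique (unmatcheds-unique tree) perm″) (cong suc len)
          (λ y∈ z∈ → unmatcheds-independent tree (sublist-⊆ perm″ y∈) (sublist-⊆ perm″ z∈)) ,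
        ≤-trans (ℕ.*-monoˡ-≤ (totalDegree G ys) (ℕ.≤-pred (≤-trans m<i (≤-reflexive (Perm.↭-length perm))))) avg ,
        subst (_< n) (weight-↭ (degree G) perm) (unmatcheds-degree tree)
    where
    perm″ : unmatcheds tree ↭ (x ∷ ys) ++ zs
    perm″ = ↭-trans perm (prep x perm′)

  Bads : List (Fin n) → Set
  Bads bs = Unique bs × (∀ {b} → b ∈ bs → ¬ Good tree (top b)) × IndependentList G bs

  bad-unmatcheds : List (Fin n)
  bad-unmatcheds = filter (¬? ∘ good? tree) (unmatcheds tree)

  bad-unmatcheds-bads : Bads bad-unmatcheds
  bad-unmatcheds-bads = Unique.filter⁺ (¬? ∘ good? tree) (unmatcheds-unique tree) ,
    (λ b∈ good → let b∈′ , ¬good = ∈-filter⁻ (¬? ∘ good? tree) b∈ in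
      ¬good (subst (Good tree) (top-isTop (proj₁ (∈unmatcheds⁻ tree b∈′))) good)) ,
    λ x∈ y∈ → unmatcheds-independent tree (proj₁ (∈-filter⁻ (¬? ∘ good? tree) x∈)) (proj₁ (∈-filter⁻ (¬? ∘ good? tree) y∈))

  singleton-bads : ∀ {b} → ¬ Good tree (top b) → Bads [ b ]
  singleton-bads {b} bad = [] ∷ [] , (λ { (here refl) → bad }) , λ { (here refl) (here refl) → loopless G b }

  pair-bads : ∀ {a b} → ¬ Good tree (top a) → ¬ Good tree (top b) → a ≢ b → ¬ Adj G a b → Bads (a ∷ b ∷ [])
  pair-bads {a} {b} bad-a bad-b a≢b ¬e =
    (a≢b ∷ []) ∷ [] ∷ [] , (λ { (here refl) → bad-a ; (there (here refl)) → bad-b }) ,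
    λ { (here refl) (here refl) → loopless G a ; (here refl) (there (here refl)) → ¬e
      ; (there (here refl)) (here refl) → ¬e ∘ Adj-sym G ; (there (here refl)) (there (here refl)) → loopless G b }

  prefix-bads : ∀ xs {ys} → Bads (xs ++ ys) → Bads xs
  prefix-bads xs (u , bad , ind) = sublist-unique u ↭-refl , bad ∘ ∈-++⁺ˡ , λ x∈ y∈ → ind (∈-++⁺ˡ x∈) (∈-++⁺ˡ y∈)

  lightest-goods : ∀ {bs} t → Bads bs → length bs + t ≡ 4 → t ≤ g →
                   ∃[ y ] ∃[ Y ] Holds (totalDegree G bs + y) × g * y ≤ t * Y × Y + g + length bs ≤ n
  lightest-goods {bs} t (u , bad , ind) four t≤g with lightest (degree G ∘ interior tree) t (goods tree) t≤g
  ... | cs , ds , perm , len , avg = weight (degree G ∘ interior tree) cs , weight (degree G ∘ interior tree) (goods tree) ,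
        subst Holds total
          (σ₄-holds (chosen tree u bad ind cs-unique cs⊆) (chosen-unique tree u bad ind cs-unique cs⊆)
            (trans (length-++ bs) (trans (cong (length bs +_) (trans (length-map (interior tree) cs) len)) four))
            (chosen-independent tree u bad ind cs-unique cs⊆)) ,
        avg , goods-degree tree u bad
    where
    cs-unique = sublist-unique (goods-unique tree) perm
    cs⊆ : cs ⊆ goods tree
    cs⊆ = sublist-⊆ perm
    total : totalDegree G (bs ++ map (interior tree) cs) ≡ totalDegree G bs + weight (degree G ∘ interior tree) cs
    total = trans (weight-++ (degree G) bs _) (cong (λ ds → totalDegree G bs + sum ds) (sym (map-∘ cs)))

  module _ (δ≥2 : ∀ v → 2 ≤ degree G v) (r-max : ∀ v → degree G v ≤ degree G r) where

    bads-degree : ∀ {bs} → Bads bs → totalDegree G bs ≤ length bs * g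
    bads-degree {bs} (_ , bad , _) = weight-bound (degree G) bs λ b∈ → bad-degree tree δ≥2 r-max (bad b∈)

    -- The bound on the bad degrees needs g ≤ m, the averaging over the good ones needs g ≥ m. So
    -- the values of g are excluded one at a time, from the largest down.
    bads-clash : ∀ {bs} t m → Bads bs → length bs + t ≡ 4 → t ≤ m → g ≡ m →
                 (∀ {b y Y} → b ≤ length bs * m → Holds (b + y) → m * y ≤ t * Y → Y + m + length bs ≤ n → ⊥) → ⊥
    bads-clash t m bads four t≤m refl clash = case lightest-goods t bads four t≤m of λ (y , Y , h₁ , h₂ , h₃) →
      clash {y = y} {Y = Y} (bads-degree bads) h₁ h₂ h₃

    module _ {k} (1≤k : 1 ≤ k)
             (none : g ≤ suc k)
             (one  : ∀ {v} → Bads [ v ] → g ≤ k)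
             (two  : ∀ {a b} → Bads (a ∷ b ∷ []) → g < k)
             (many : 2 ≤ length bad-unmatcheds → length bad-unmatcheds + g ≤ k) where

      private
        j = length bad-unmatcheds

        covered : unmatcheds tree ⊆ goods tree ++ bad-unmatcheds
        covered {c} c∈ = case good? tree c of λ
          { (yes good) → ∈-++⁺ˡ (∈goods⁺ tree good)
          ; (no bad)   → ∈-++⁺ʳ (goods tree) (∈-filter⁺ (¬? ∘ good? tree) c∈ bad) }

        i≤g+j : i ≤ g + j
        i≤g+j = ≤-trans (Unique-⊆-length (unmatcheds-unique tree) covered) (≤-reflexive (length-++ (goods tree)))

        i<g+j : ∀ {m} → Good tree m → Matched m → i < g + j
        i<g+j {m} good matched = ≤-trans
          (Unique-⊆-length {xs = m ∷ unmatcheds tree}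
            (All.tabulate (λ c∈ m≡c → proj₂ (∈unmatcheds⁻ tree c∈) (subst Matched m≡c matched)) ∷ unmatcheds-unique tree)
            λ { (here refl) → ∈-++⁺ˡ (∈goods⁺ tree good) ; (there c∈) → covered c∈ })
          (≤-reflexive (length-++ (goods tree)))

        some-matched : 2 ≤ i → ∃[ q ] IsTop q × Matched q
        some-matched 2≤i with two-distinct (unmatcheds-unique tree) 2≤i
        ... | c , d , c∈ , d∈ , c≢d = case c ≟ r of λ
          { (no c≢r)   → parent c∈ c≢r
          ; (yes refl) → parent d∈ (c≢d ∘ sym) }
          where
          parent : ∀ {c} → c ∈ unmatcheds tree → c ≢ r → ∃[ q ] IsTop q × Matched q
          parent {c} c∈ c≢r with ∈unmatcheds⁻ tree c∈
          ... | inj₁ c≡r , _  = ⊥-elim (c≢r c≡r)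
          ... | inj₂ bc , ¬mc = top (p c) , isTop-top _ , matched⁺ (bc , refl) ¬mc

        bad-top : ∀ {q} → IsTop q → ¬ Good tree q → ¬ Good tree (top q)
        bad-top tq bad = bad ∘ subst (Good tree) (top-isTop tq)

        -- Since i ≤ g + j, only j ≤ 1 leaves an excess of one over k to be removed. A matched good
        -- component does so, being counted in g but not in i. Otherwise all matched components are
        -- bad: for j = 0 the parent of an unmatched component is fed to `one`, and for j = 1 the
        -- two matched neighbours of the bad c are fed to `two`.
        cases : ∀ bs → bs ≡ bad-unmatcheds → Dec (∃[ m ] Good tree m × Matched m) → ¬ k < i
        cases (_ ∷ _ ∷ _) eq _ k<i = n≮n _ (ℕ.<-≤-trans k<i (≤-trans i≤g+j
          (≤-trans (≤-reflexive (ℕ.+-comm g j)) (many (subst ((2 ≤_) ∘ length) eq (s≤s (s≤s z≤n)))))))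
        cases [] eq (yes (m , good , matched)) k<i = n≮n _ (begin-strict
          suc k   <⟨ s≤s k<i ⟩
          suc i   ≤⟨ i<g+j good matched ⟩
          g + j   ≡⟨ cong ((g +_) ∘ length) eq ⟨
          g + 0   ≡⟨ ℕ.+-identityʳ g ⟩
          g       ≤⟨ none ⟩
          suc k   ∎)
          where open ≤-Reasoning
        cases (c ∷ []) eq (yes (m , good , matched)) k<i = n≮n _ (begin-strict
          suc k   <⟨ s≤s k<i ⟩
          suc i   ≤⟨ i<g+j good matched ⟩
          g + j   ≡⟨ cong ((g +_) ∘ length) eq ⟨
          g + 1   ≡⟨ ℕ.+-comm g 1 ⟩
          suc g   ≤⟨ s≤s (one (subst Bads (sym eq) bad-unmatcheds-bads)) ⟩
          suc k   ∎)
          where open ≤-Reasoning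
        cases [] eq (no ¬good) k<i with some-matched (≤-trans (s≤s 1≤k) k<i)
        ... | q , tq , mq = n≮n _ (begin-strict
          k       <⟨ k<i ⟩
          i       ≤⟨ i≤g+j ⟩
          g + j   ≡⟨ cong ((g +_) ∘ length) eq ⟨
          g + 0   ≡⟨ ℕ.+-identityʳ g ⟩
          g       ≤⟨ one (singleton-bads (bad-top tq λ good → ¬good (q , good , mq))) ⟩
          k       ∎)
          where open ≤-Reasoning
        cases (c ∷ []) eq (no ¬good) k<i
          with two-across tree δ≥2 r-max (∈unmatcheds⁻ tree (proj₁ c∈)) (proj₂ c∈)
          where c∈ = ∈-filter⁻ (¬? ∘ good? tree) (subst (c ∈_) eq (here refl))
        ... | a , b , (ta , ma) , (tb , mb) , a≢b , ¬e = n≮n _ (begin-strict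
          k       <⟨ k<i ⟩
          i       ≤⟨ i≤g+j ⟩
          g + j   ≡⟨ cong ((g +_) ∘ length) eq ⟨
          g + 1   ≡⟨ ℕ.+-comm g 1 ⟩
          suc g   ≤⟨ two (pair-bads (bad-top ta λ good → ¬good (a , good , ma))
                                    (bad-top tb λ good → ¬good (b , good , mb)) a≢b ¬e) ⟩
          k       ∎)
          where open ≤-Reasoning

      unmatcheds-≤ : i ≤ k
      unmatcheds-≤ = ℕ.≮⇒≥ (cases bad-unmatcheds refl (any? λ m → good? tree m ×-dec matched? m))

  minimum-degree : 2 ≤ i → (∀ {x} → x ∈ unmatcheds tree → 2 ≤ degree G x) →
                   (∀ v → degree G v ≤ degree G r) → ∀ v → 2 ≤ degree G v
  minimum-degree 2≤i unmatched≥2 r-max v = case v ≟ r of λ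
    { (no v≢r) → non-root v≢r
    ; (yes refl) → let c , d , _ , _ , c≢d = two-distinct (unmatcheds-unique tree) 2≤i in case c ≟ r of λ
        { (no c≢r) → ≤-trans (non-root c≢r) (r-max c)
        ; (yes c≡r) → ≤-trans (non-root λ d≡r → c≢d (trans c≡r (sym d≡r))) (r-max d) } }
    where
    non-root : ∀ {v} → v ≢ r → 2 ≤ degree G v
    non-root v≢r = ℕ.≮⇒≥ λ d<2 → ℕ.<⇒≱ d<2 (unmatched≥2 (∈unmatcheds⁺ tree (leaf-unmatched tree v≢r (ℕ.≤-pred d<2))))

-- Arithmetic

-- Linear-arithmetic certificates: a combination L ≤ R of hypotheses is refuted by a
-- polynomial identity L = 1 + R + d.
infixl 6 _⊕_
infixr 7 _⊗_

_⊕_ : ∀ {a b c d} → a ≤ b → c ≤ d → a + c ≤ b + d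
_⊕_ = ℕ.+-mono-≤

_⊗_ : ∀ {a b} m → a ≤ b → m * a ≤ m * b
m ⊗ h = ℕ.*-monoʳ-≤ m h

refute : ∀ {L R} → L ≤ R → ∀ d → L ≡ suc (R + d) → ⊥
refute {L} {R} le d eq = n≮n R (≤-trans (s≤s (ℕ.m≤m+n R d)) (≤-trans (≤-reflexive (sym eq)) le))

module Case3 where
  clash : ∀ {n y Y} → 8 ≤ n → 2 * n ≤ y + 7 → 4 * y ≤ 4 * Y → Y < n → ⊥
  clash {n} {y} {Y} h h₁ h₂ h₃ = refute (4 ⊗ h₁ ⊕ h₂ ⊕ 4 ⊗ h₃ ⊕ 4 ⊗ h) 7 (identity n y Y)
    where
    identity : ∀ n y Y → 4 * (2 * n) + 4 * y + 4 * suc Y + 4 * 8 ≡ suc (4 * (y + 7) + 4 * Y + 4 * n + 4 * n + 7)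
    identity = solve-∀

module Case4 where
  clash : ∀ {n y Y} → n ≤ y → 5 * y ≤ 4 * Y → Y < n → ⊥
  clash {n} {y} {Y} h₁ h₂ h₃ = refute (5 ⊗ h₁ ⊕ h₂ ⊕ 4 ⊗ h₃) (n + 3) (identity n y Y)
    where
    identity : ∀ n y Y → 5 * n + 5 * y + 4 * suc Y ≡ suc (5 * y + 4 * Y + 4 * n + (n + 3))
    identity = solve-∀

module Case5 where
  clash : ∀ {n y Y} → 11 ≤ n → n ≤ y + 1 → 6 * y ≤ 4 * Y → Y < n → ⊥
  clash {n} {y} {Y} h h₁ h₂ h₃ = refute (6 ⊗ h₁ ⊕ h₂ ⊕ 4 ⊗ h₃ ⊕ 2 ⊗ h) 19 (identity n y Y)
    where
    identity : ∀ n y Y → 6 * n + 6 * y + 4 * suc Y + 2 * 11 ≡ suc (6 * (y + 1) + 4 * Y + 4 * n + 2 * n + 19)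
    identity = solve-∀

module Case6 where
  -- Four of seven degrees take at most 4/7 of n - 1, which barely exceeds n/2; the surplus has room
  -- for the 5/2 of the bound only when n is this large.
  43≤n : ∀ {n y Y} → n + 5 ≤ 2 * y → 7 * y ≤ 4 * Y → Y < n → 43 ≤ n
  43≤n {n} {y} {Y} h₁ h₂ h₃ = ℕ.≮⇒≥ λ h →
    refute (7 ⊗ h₁ ⊕ 2 ⊗ h₂ ⊕ 8 ⊗ h₃ ⊕ h) 0 (identity n y Y)
    where
    identity : ∀ n y Y → 7 * (n + 5) + 2 * (7 * y) + 8 * suc Y + suc n ≡
                         suc (7 * (2 * y) + 2 * (4 * Y) + 8 * n + 43 + 0)
    identity = solve-∀

  -- Three of six degrees take at most half of Y, so n + 5 ≤ 2d + Y ≤ d + n - 1; the summand 5 turns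
  -- into the 6.
  6≤d : ∀ {n d y Y} → n + 5 ≤ 2 * (d + y) → 6 * y ≤ 3 * Y → d + Y < n → 6 ≤ d
  6≤d {n} {d} {y} {Y} h₁ h₂ h₃ = ℕ.≮⇒≥ λ h →
    refute (3 ⊗ h₁ ⊕ h₂ ⊕ 3 ⊗ h₃ ⊕ 3 ⊗ h) 2 (identity n d y Y)
    where
    identity : ∀ n d y Y → 3 * (n + 5) + 6 * y + 3 * suc (d + Y) + 3 * suc d ≡
                           suc (3 * (2 * (d + y)) + 3 * Y + 3 * n + 3 * 6 + 2)
    identity = solve-∀

  none : ∀ {n y Y} → n + 5 ≤ 2 * (0 + y) → 8 * y ≤ 4 * Y → Y + 8 + 0 ≤ n → ⊥
  none {n} {y} {Y} h₁ h₂ h₃ = refute (4 ⊗ h₁ ⊕ h₂ ⊕ 4 ⊗ h₃) 51 (identity n y Y)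
    where
    identity : ∀ n y Y → 4 * (n + 5) + 8 * y + 4 * (Y + 8 + 0) ≡ suc (4 * (2 * (0 + y)) + 4 * Y + 4 * n + 51)
    identity = solve-∀

  one : ∀ {n b y Y} → 43 ≤ n → b ≤ 1 * 7 → n + 5 ≤ 2 * (b + y) → 7 * y ≤ 3 * Y → Y + 7 + 1 ≤ n → ⊥
  one {n} {b} {y} {Y} h h₀ h₁ h₂ h₃ = refute (7 ⊗ h₁ ⊕ 2 ⊗ h₂ ⊕ 6 ⊗ h₃ ⊕ 14 ⊗ h₀ ⊕ h) 27 (identity n b y Y)
    where
    identity : ∀ n b y Y → 7 * (n + 5) + 2 * (7 * y) + 6 * (Y + 7 + 1) + 14 * b + 43 ≡
                           suc (7 * (2 * (b + y)) + 2 * (3 * Y) + 6 * n + 14 * (1 * 7) + n + 27)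
    identity = solve-∀

  two : ∀ {n b y Y} → 43 ≤ n → b ≤ 2 * 6 → n + 5 ≤ 2 * (b + y) → 6 * y ≤ 2 * Y → Y + 6 + 2 ≤ n → ⊥
  two {n} {b} {y} {Y} h h₀ h₁ h₂ h₃ = refute (3 ⊗ h₁ ⊕ h₂ ⊕ 2 ⊗ h₃ ⊕ 6 ⊗ h₀ ⊕ h) 1 (identity n b y Y)
    where
    identity : ∀ n b y Y → 3 * (n + 5) + 6 * y + 2 * (Y + 6 + 2) + 6 * b + 43 ≡
                           suc (3 * (2 * (b + y)) + 2 * Y + 2 * n + 6 * (2 * 6) + n + 1)
    identity = solve-∀

-- Here k = 7 + e, and 4 n ≤ (k + 2) s + 4 k + 7 bounds the degree sum s.
module Case7 where

  -- Each field is what the refutation of that name needs; for k ≥ 10 the first one is the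
  -- order bound of the theorem, for k ≤ 9 the numerical bounds on n imply them all.
  record Large (e n : ℕ) : Set where
    field
      for-one  : 614 + 221 * e + 26 * (e * e) + e * e * e ≤ (5 + e) * n
      for-leaf : 255 + 73 * e + 5 * (e * e) ≤ (1 + e) * n
      for-two  : 715 + 313 * e + 44 * (e * e) + 2 * (e * e * e) ≤ (6 + 2 * e) * n
      for-many : 117 + 21 * e + e * e ≤ n

  Bound : ℕ → ℕ → ℕ → Set
  Bound e n s = 4 * n ≤ (9 + e) * s + (35 + 4 * e)

  private
    scale : ∀ {b c n} m → b ≤ n → c ≤ m * b → c ≤ m * n
    scale m b≤n c≤mb = ≤-trans c≤mb (m ⊗ b≤n)

  large-7 : ∀ {n} → 286 ≤ n → Large 0 n
  large-7 {n} h = record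
    { for-one  = scale 5 h (ℕ.m≤m+n 614 816)
    ; for-leaf = scale 1 h (ℕ.m≤m+n 255 31)
    ; for-two  = scale 6 h (ℕ.m≤m+n 715 1001)
    ; for-many = ≤-trans (ℕ.m≤m+n 117 169) h }

  large-8 : ∀ {n} → 207 ≤ n → Large 1 n
  large-8 {n} h = record
    { for-one  = scale 6 h (ℕ.m≤m+n 862 380)
    ; for-leaf = scale 2 h (ℕ.m≤m+n 333 81)
    ; for-two  = scale 8 h (ℕ.m≤m+n 1074 582)
    ; for-many = ≤-trans (ℕ.m≤m+n 139 68) h }

  large-9 : ∀ {n} → 190 ≤ n → Large 2 n
  large-9 {n} h = record
    { for-one  = scale 7 h (ℕ.m≤m+n 1168 162)
    ; for-leaf = scale 3 h (ℕ.m≤m+n 421 149)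
    ; for-two  = scale 10 h (ℕ.m≤m+n 1533 367)
    ; for-many = ≤-trans (ℕ.m≤m+n 163 27) h }

  -- With k = 10 + e the hypothesis reads k² + 7 k + 18 + 33 / (k - 2) < n.
  large-10 : ∀ {e n} → ((10 + e) * (10 + e) + 7 * (10 + e) + 18) * (8 + e) + 33 < n * (8 + e) → Large (3 + e) n
  large-10 {e} {n} h = record
    { for-one  = ≤-trans (≤-reflexive (one e)) (≤-trans h (≤-reflexive (ℕ.*-comm n (8 + e))))
    ; for-leaf = ≤-trans (≤-trans (ℕ.m≤m+n _ _) (≤-reflexive (leaf e))) ((1 + (3 + e)) ⊗ n-large)
    ; for-two  = ≤-trans (≤-trans (ℕ.m≤m+n _ _) (≤-reflexive (two e))) ((6 + 2 * (3 + e)) ⊗ n-large)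
    ; for-many = ≤-trans (≤-reflexive (many e)) n-large }
    where
    n-large : suc ((10 + e) * (10 + e) + 7 * (10 + e) + 18) ≤ n
    n-large = ℕ.*-cancelʳ-< (8 + e) ((10 + e) * (10 + e) + 7 * (10 + e) + 18) n (ℕ.≤-<-trans (ℕ.m≤m+n _ 33) h)
    one : ∀ e → 614 + 221 * (3 + e) + 26 * ((3 + e) * (3 + e)) + (3 + e) * (3 + e) * (3 + e) ≡
                suc (((10 + e) * (10 + e) + 7 * (10 + e) + 18) * (8 + e) + 33)
    one = solve-∀
    leaf : ∀ e → 255 + 73 * (3 + e) + 5 * ((3 + e) * (3 + e)) + (237 + 194 * e + 26 * (e * e) + e * e * e) ≡
                 (1 + (3 + e)) * suc ((10 + e) * (10 + e) + 7 * (10 + e) + 18)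
    leaf = solve-∀
    two : ∀ e → 715 + 313 * (3 + e) + 44 * ((3 + e) * (3 + e)) + 2 * ((3 + e) * (3 + e) * (3 + e))
                  + (164 + 71 * e + 4 * (e * e)) ≡
                (6 + 2 * (3 + e)) * suc ((10 + e) * (10 + e) + 7 * (10 + e) + 18)
    two = solve-∀
    many : ∀ e → 117 + 21 * (3 + e) + (3 + e) * (3 + e) ≡ suc ((10 + e) * (10 + e) + 7 * (10 + e) + 18)
    many = solve-∀

  module _ {e n : ℕ} (large : Large e n) where
    open Large large

    -- After averaging, n keeps the coefficient 4k - 3(k + 2) = k - 6, which is positive from k = 7
    -- on.
    2≤d : ∀ {d y Y} → Bound e n (d + y) → (7 + e) * y ≤ 3 * Y → d + Y < n → 2 ≤ d
    2≤d {d} {y} {Y} h₁ h₂ h₃ = ℕ.≮⇒≥ λ h →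
      refute ((7 + e) ⊗ h₁ ⊕ (9 + e) ⊗ h₂ ⊕ (3 * (9 + e)) ⊗ h₃ ⊕ ((9 + e) * (4 + e)) ⊗ h ⊕ for-leaf) 0 (identity e n d y Y)
      where
      identity : ∀ e n d y Y →
        (7 + e) * (4 * n) + (9 + e) * ((7 + e) * y) + 3 * (9 + e) * suc (d + Y) + (9 + e) * (4 + e) * suc d
          + (255 + 73 * e + 5 * (e * e)) ≡
        suc ((7 + e) * ((9 + e) * (d + y) + (35 + 4 * e)) + (9 + e) * (3 * Y) + 3 * (9 + e) * n
          + (9 + e) * (4 + e) * 2 + (1 + e) * n + 0)
      identity = solve-∀

    -- The disjoint closed neighbourhoods give Y ≤ n - (k + 2), hence (k + 2) y ≤ 4n - 4k - 8,
    -- exactly one less than `Bound` demands.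
    none : ∀ {y Y} → Bound e n (0 + y) → (9 + e) * y ≤ 4 * Y → Y + (9 + e) + 0 ≤ n → ⊥
    none {y} {Y} h₁ h₂ h₃ = refute (h₁ ⊕ h₂ ⊕ 4 ⊗ h₃) 0 (identity e n y Y)
      where
      identity : ∀ e n y Y → 4 * n + (9 + e) * y + 4 * (Y + (9 + e) + 0) ≡
                 suc ((9 + e) * (0 + y) + (35 + 4 * e) + 4 * Y + 4 * n + 0)
      identity = solve-∀

    -- Eliminating b, y and Y leaves (k - 2) n ≤ k³ + 5k² + 4k - 3, and the right-hand side is (k² +
    -- 7k + 18)(k - 2) + 33.
    one : ∀ {b y Y} → b ≤ 1 * (8 + e) → Bound e n (b + y) → (8 + e) * y ≤ 3 * Y → Y + (8 + e) + 1 ≤ n → ⊥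
    one {b} {y} {Y} h₀ h₁ h₂ h₃ =
      refute ((8 + e) ⊗ h₁ ⊕ (9 + e) ⊗ h₂ ⊕ (3 * (9 + e)) ⊗ h₃ ⊕ ((9 + e) * (8 + e)) ⊗ h₀ ⊕ for-one) 0 (identity e n b y Y)
      where
      identity : ∀ e n b y Y →
        (8 + e) * (4 * n) + (9 + e) * ((8 + e) * y) + 3 * (9 + e) * (Y + (8 + e) + 1) + (9 + e) * (8 + e) * b
          + (614 + 221 * e + 26 * (e * e) + e * e * e) ≡
        suc ((8 + e) * ((9 + e) * (b + y) + (35 + 4 * e)) + (9 + e) * (3 * Y) + 3 * (9 + e) * n
          + (9 + e) * (8 + e) * (1 * (8 + e)) + (5 + e) * n + 0)
      identity = solve-∀

    -- With t good vertices chosen among g components, n keeps the coefficient 4g - t(k + 2). Here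
    -- this is 2(k - 2), twice that of `for-one`; the same formula gives the multiples of n in
    -- `two′` and `three`.
    two : ∀ {b y Y} → b ≤ 2 * (7 + e) → Bound e n (b + y) → (7 + e) * y ≤ 2 * Y → Y + (7 + e) + 2 ≤ n → ⊥
    two {b} {y} {Y} h₀ h₁ h₂ h₃ =
      refute ((7 + e) ⊗ h₁ ⊕ (9 + e) ⊗ h₂ ⊕ (2 * (9 + e)) ⊗ h₃ ⊕ ((9 + e) * (7 + e)) ⊗ h₀ ⊕ 2 ⊗ for-one)
        (262 + 65 * e + 4 * (e * e)) (identity e n b y Y)
      where
      identity : ∀ e n b y Y →
        (7 + e) * (4 * n) + (9 + e) * ((7 + e) * y) + 2 * (9 + e) * (Y + (7 + e) + 2) + (9 + e) * (7 + e) * b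
          + 2 * (614 + 221 * e + 26 * (e * e) + e * e * e) ≡
        suc ((7 + e) * ((9 + e) * (b + y) + (35 + 4 * e)) + (9 + e) * (2 * Y) + 2 * (9 + e) * n
          + (9 + e) * (7 + e) * (2 * (7 + e)) + 2 * ((5 + e) * n) + (262 + 65 * e + 4 * (e * e)))
      identity = solve-∀

    two′ : ∀ {b y Y} → b ≤ 2 * (6 + e) → Bound e n (b + y) → (6 + e) * y ≤ 2 * Y → Y + (6 + e) + 2 ≤ n → ⊥
    two′ {b} {y} {Y} h₀ h₁ h₂ h₃ =
      refute ((6 + e) ⊗ h₁ ⊕ (9 + e) ⊗ h₂ ⊕ (2 * (9 + e)) ⊗ h₃ ⊕ ((9 + e) * (6 + e)) ⊗ h₀ ⊕ for-two) 0 (identity e n b y Y)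
      where
      identity : ∀ e n b y Y →
        (6 + e) * (4 * n) + (9 + e) * ((6 + e) * y) + 2 * (9 + e) * (Y + (6 + e) + 2) + (9 + e) * (6 + e) * b
          + (715 + 313 * e + 44 * (e * e) + 2 * (e * e * e)) ≡
        suc ((6 + e) * ((9 + e) * (b + y) + (35 + 4 * e)) + (9 + e) * (2 * Y) + 2 * (9 + e) * n
          + (9 + e) * (6 + e) * (2 * (6 + e)) + (6 + 2 * e) * n + 0)
      identity = solve-∀

    three : ∀ {b y Y} → b ≤ 3 * (5 + e) → Bound e n (b + y) → (5 + e) * y ≤ 1 * Y → Y + (5 + e) + 3 ≤ n → ⊥
    three {b} {y} {Y} h₀ h₁ h₂ h₃ =
      refute ((5 + e) ⊗ h₁ ⊕ (9 + e) ⊗ h₂ ⊕ (9 + e) ⊗ h₃ ⊕ ((9 + e) * (5 + e)) ⊗ h₀ ⊕ (11 + 3 * e) ⊗ for-many)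
        (508 + 199 * e + 14 * (e * e)) (identity e n b y Y)
      where
      identity : ∀ e n b y Y →
        (5 + e) * (4 * n) + (9 + e) * ((5 + e) * y) + (9 + e) * (Y + (5 + e) + 3) + (9 + e) * (5 + e) * b
          + (11 + 3 * e) * (117 + 21 * e + e * e) ≡
        suc ((5 + e) * ((9 + e) * (b + y) + (35 + 4 * e)) + (9 + e) * (1 * Y) + (9 + e) * n
          + (9 + e) * (5 + e) * (3 * (5 + e)) + (11 + 3 * e) * n + (508 + 199 * e + 14 * (e * e)))
      identity = solve-∀

    four : ∀ {b g} → b ≤ 4 * g → g ≤ 7 + e → Bound e n b → ⊥
    four {b} {g} h₀ h h₁ =
      refute (h₁ ⊕ (9 + e) ⊗ h₀ ⊕ (4 * (9 + e)) ⊗ h ⊕ 4 ⊗ for-many) (180 + 16 * e) (identity e n b g)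
      where
      identity : ∀ e n b g →
        4 * n + (9 + e) * b + 4 * (9 + e) * g + 4 * (117 + 21 * e + e * e) ≡
        suc ((9 + e) * b + (35 + 4 * e) + (9 + e) * (4 * g) + 4 * (9 + e) * (7 + e) + 4 * n + (180 + 16 * e))
      identity = solve-∀

-- Bounding the unmatched components in each case

module _ {n} (G : Graph n) where

  σ₄-Holds : (ℕ → Set) → Set
  σ₄-Holds Holds = ∀ xs → Unique xs → length xs ≡ 4 → IndependentList G xs → Holds (totalDegree G xs)

module _ {n} (G : Graph n) (connected : Connected G) where

  -- At most k + 2 unmatched components mean at most k + 1 non-mates, and the common colour of the
  -- mates is the one remaining. The root is chosen of maximum degree for the sake of `bad-degree`
  -- and `minimum-degree`.
  few-unmatcheds⇒cfc≤ : 1 ≤ n → ∀ k →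
    (∀ {r} (tree : SpanningTree G r) → (∀ v → degree G v ≤ degree G r) → length (unmatcheds tree) ≤ 2 + k) →
    ∃[ c ] IsCfc G c × c ≤ 2 + k
  few-unmatcheds⇒cfc≤ (s≤s z≤n) k few with maximum (degree G) zero (tabulate suc)
  ... | r , _ , perm , max = colourable⇒cfc≤ G (conflict-free-colourable tree
          (ℕ.≤-pred (≤-trans (nonMates<unmatcheds tree) (few tree λ v → max (Perm.∈-resp-↭ perm (∈-allFin v))))))
    where
    tree = bfs-tree G connected r

module _ {n} (G : Graph n) {r} (tree : SpanningTree G r) where

  private
    i = length (unmatcheds tree)
    g = length (goods tree)

  few-3 : 8 ≤ n → σ₄-Holds G (λ s → 2 * n ≤ s + 7) → i ≤ 3
  few-3 n≥8 holds = ℕ.≮⇒≥ λ 4≤i →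
    case lightest-unmatcheds 4≤i of λ (y , Y , h₁ , h₂ , h₃) →
      Case3.clash n≥8 h₁ (≤-trans (ℕ.*-monoˡ-≤ y 4≤i) h₂) h₃
    where open Selection tree (λ s → 2 * n ≤ s + 7) holds

  few-4 : σ₄-Holds G (n ≤_) → i ≤ 4
  few-4 holds = ℕ.≮⇒≥ λ 5≤i →
    case lightest-unmatcheds (ℕ.<⇒≤ 5≤i) of λ (y , Y , h₁ , h₂ , h₃) →
      Case4.clash h₁ (≤-trans (ℕ.*-monoˡ-≤ y 5≤i) h₂) h₃
    where open Selection tree (n ≤_) holds

  few-5 : 11 ≤ n → σ₄-Holds G (λ s → n ≤ s + 1) → i ≤ 5
  few-5 n≥11 holds = ℕ.≮⇒≥ λ 6≤i →
    case lightest-unmatcheds (≤-trans (ℕ.m≤m+n 4 2) 6≤i) of λ (y , Y , h₁ , h₂ , h₃) →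
      Case5.clash n≥11 h₁ (≤-trans (ℕ.*-monoˡ-≤ y 6≤i) h₂) h₃
    where open Selection tree (λ s → n ≤ s + 1) holds

  module Six (r-max : ∀ v → degree G v ≤ degree G r) (holds : σ₄-Holds G (λ s → n + 5 ≤ 2 * s)) (7≤i : 7 ≤ i) where
    open Selection tree (λ s → n + 5 ≤ 2 * s) holds

    43≤n : 43 ≤ n
    43≤n = case lightest-unmatcheds (≤-trans (ℕ.m≤m+n 4 3) 7≤i) of λ (y , Y , h₁ , h₂ , h₃) →
      Case6.43≤n {y = y} {Y = Y} h₁ (≤-trans (ℕ.*-monoˡ-≤ y 7≤i) h₂) h₃

    6≤d : ∀ {x} → x ∈ unmatcheds tree → 6 ≤ degree G x
    6≤d x∈ = case lightest-with x∈ 7≤i (ℕ.m≤m+n 3 3) of λ (y , Y , h₁ , h₂ , h₃) →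
      Case6.6≤d {n = n} {y = y} {Y = Y} h₁ h₂ h₃

    δ≥2 : ∀ v → 2 ≤ degree G v
    δ≥2 = minimum-degree (≤-trans (ℕ.m≤m+n 2 5) 7≤i) (≤-trans (ℕ.m≤m+n 2 4) ∘ 6≤d) r-max

    none : g ≤ 7
    none = ℕ.≮⇒≥ λ 8≤g →
      case lightest-goods {bs = []} 4 ([] , (λ ()) , λ ()) refl (≤-trans (ℕ.m≤m+n 4 4) 8≤g) of λ (y , Y , h₁ , h₂ , h₃) →
        Case6.none {y = y} {Y = Y} h₁ (≤-trans (ℕ.*-monoˡ-≤ y 8≤g) h₂)
          (≤-trans (ℕ.+-monoˡ-≤ 0 (ℕ.+-monoʳ-≤ Y 8≤g)) h₃)

    one : ∀ {v} → Bads (v ∷ []) → g ≤ 6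
    one bads = ℕ.≮⇒≥ λ 7≤g → bads-clash δ≥2 r-max 3 7 bads refl (ℕ.m≤m+n 3 4) (ℕ.≤-antisym none 7≤g) (Case6.one 43≤n)

    two : ∀ {a b} → Bads (a ∷ b ∷ []) → g < 6
    two {a} {b} bads = ℕ.≤∧≢⇒< (one (prefix-bads (a ∷ []) bads))
      λ eq → bads-clash δ≥2 r-max 2 6 bads refl (ℕ.m≤m+n 2 4) eq (Case6.two 43≤n)

    -- Two bad unmatched components cannot occur: an unmatched vertex has degree at least 6, a bad
    -- one has degree at most g, and two nonadjacent bad ones force g < 6.
    many : ∀ bs → bs ≡ bad-unmatcheds → 2 ≤ length bs → length bs + g ≤ 6
    many (_ ∷ []) _ (s≤s ())
    many (a ∷ b ∷ bs) eq _ = ⊥-elim (ℕ.<⇒≱ (two (prefix-bads (a ∷ b ∷ []) bads)) 6≤g)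
      where
      bads : Bads (a ∷ b ∷ bs)
      bads = subst Bads (sym eq) bad-unmatcheds-bads
      6≤g : 6 ≤ g
      6≤g = ≤-trans (6≤d (proj₁ (∈-filter⁻ (¬? ∘ good? tree) (subst (a ∈_) eq (here refl)))))
                    (bad-degree tree δ≥2 r-max (proj₁ (proj₂ bads) (here refl)))

    i≤6 : i ≤ 6
    i≤6 = unmatcheds-≤ δ≥2 r-max (ℕ.m≤m+n 1 5) none one two (many _ refl)

  module Seven {e} (large : Case7.Large e n) (r-max : ∀ v → degree G v ≤ degree G r)
               (holds : σ₄-Holds G (Case7.Bound e n)) (k<i : 7 + e < i) where
    open Selection tree (Case7.Bound e n) holds

    δ≥2 : ∀ v → 2 ≤ degree G v
    δ≥2 = minimum-degree (≤-trans (ℕ.m≤m+n 2 (6 + e)) k<i)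
      (λ x∈ → case lightest-with x∈ k<i (ℕ.m≤m+n 3 (4 + e)) of λ (y , Y , h₁ , h₂ , h₃) →
        Case7.2≤d large {y = y} {Y = Y} h₁ h₂ h₃) r-max

    none : g ≤ 8 + e
    none = ℕ.≮⇒≥ λ le →
      case lightest-goods {bs = []} 4 ([] , (λ ()) , λ ()) refl (≤-trans (ℕ.m≤m+n 4 (5 + e)) le) of λ
        (y , Y , h₁ , h₂ , h₃) → Case7.none large {y = y} {Y = Y} h₁ (≤-trans (ℕ.*-monoˡ-≤ y le) h₂)
          (≤-trans (ℕ.+-monoˡ-≤ 0 (ℕ.+-monoʳ-≤ Y le)) h₃)

    one : ∀ {v} → Bads (v ∷ []) → g ≤ 7 + e
    one bads = ℕ.≮⇒≥ λ le →
      bads-clash δ≥2 r-max 3 (8 + e) bads refl (ℕ.m≤m+n 3 (5 + e)) (ℕ.≤-antisym none le) (Case7.one large)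

    -- The values k and k - 1 of g are excluded in turn, because two bad unmatched components count
    -- as two in `many` and so call for g ≤ k - 2.
    two : ∀ {a b} → Bads (a ∷ b ∷ []) → g < 6 + e
    two {a} bads = ℕ.≤∧≢⇒<
      (ℕ.≤-pred (ℕ.≤∧≢⇒< (one (prefix-bads (a ∷ []) bads))
        λ eq → bads-clash δ≥2 r-max 2 (7 + e) bads refl (ℕ.m≤m+n 2 (5 + e)) eq (Case7.two large)))
      λ eq → bads-clash δ≥2 r-max 2 (6 + e) bads refl (ℕ.m≤m+n 2 (4 + e)) eq (Case7.two′ large)

    many : ∀ bs → Bads bs → 2 ≤ length bs → length bs + g ≤ 7 + e
    many (_ ∷ []) _ (s≤s ())
    many (_ ∷ _ ∷ []) bads _ = s≤s (two bads)
    many (a ∷ b ∷ c ∷ []) bads _ = s≤s (s≤s (ℕ.≤∧≢⇒< (ℕ.≤-pred (two (prefix-bads (a ∷ b ∷ []) bads)))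
      λ eq → bads-clash δ≥2 r-max 1 (5 + e) bads refl (s≤s z≤n) eq (Case7.three large)))
    many (a ∷ b ∷ c ∷ d ∷ bs) bads _ = ⊥-elim
      (Case7.four large (bads-degree δ≥2 r-max bads₄) (one (prefix-bads (a ∷ []) bads))
        (holds (a ∷ b ∷ c ∷ d ∷ []) (proj₁ bads₄) refl (proj₂ (proj₂ bads₄))))
      where
      bads₄ = prefix-bads (a ∷ b ∷ c ∷ d ∷ []) bads

    i≤k : i ≤ 7 + e
    i≤k = unmatcheds-≤ δ≥2 r-max (s≤s z≤n) none one
      (λ bads → ≤-trans (two bads) (ℕ.n≤1+n _)) (many _ bad-unmatcheds-bads)

  few-6 : (∀ v → degree G v ≤ degree G r) → σ₄-Holds G (λ s → n + 5 ≤ 2 * s) → i ≤ 6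
  few-6 r-max holds = ℕ.≮⇒≥ λ 7≤i → ℕ.<⇒≱ 7≤i (Six.i≤6 r-max holds 7≤i)

  few-7 : ∀ {e} → Case7.Large e n → (∀ v → degree G v ≤ degree G r) → σ₄-Holds G (Case7.Bound e n) → i ≤ 7 + e
  few-7 large r-max holds = ℕ.≮⇒≥ λ k<i → ℕ.<⇒≱ k<i (Seven.i≤k large r-max holds k<i)

-- Clearing denominators in the hypotheses

/-≤-integer : ∀ i d s → i / suc d ℚ.≤ (ℤ.+ s) / 1 → i ℤ.≤ ℤ.+ (s * suc d)
/-≤-integer i d s le with fromℚᵘ-cancel-≤ {ℚᵘ.mkℚᵘ i d} {ℚᵘ.mkℚᵘ (ℤ.+ s) 0} le
... | ℚᵘ.*≤* le′ = subst₂ ℤ._≤_ (ℤ.*-identityʳ i) (sym (ℤ.pos-* s (suc d))) le′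

minus-≤ : ∀ {i} b {c} → i ℤ.- ℤ.+ b ℤ.≤ ℤ.+ c → i ℤ.≤ ℤ.+ (c + b)
minus-≤ {i} b {c} le = subst (ℤ._≤ _)
  (trans (ℤ.+-assoc i (ℤ.- (ℤ.+ b)) (ℤ.+ b)) (trans (cong (λ j → i ℤ.+ j) (ℤ.+-inverseˡ (ℤ.+ b))) (ℤ.+-identityʳ i)))
  (ℤ.+-monoˡ-≤ (ℤ.+ b) le)

fromℚᵘ-+-cancel-< : ∀ a b c → ℚ.fromℚᵘ a ℚ.+ ℚ.fromℚᵘ b ℚ.< ℚ.fromℚᵘ c → a ℚᵘ.+ b ℚᵘ.< c
fromℚᵘ-+-cancel-< a b c lt = ℚᵘ.<-respʳ-≃ (ℚ.toℚᵘ-fromℚᵘ c) (ℚᵘ.<-respˡ-≃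
  (ℚᵘ.≃-trans (ℚ.toℚᵘ-homo-+ (ℚ.fromℚᵘ a) (ℚ.fromℚᵘ b)) (ℚᵘ.+-cong (ℚ.toℚᵘ-fromℚᵘ a) (ℚ.toℚᵘ-fromℚᵘ b)))
  (ℚ.toℚᵘ-mono-< lt))

mixed-fraction-< : ∀ a b d .{{_ : ℕ.NonZero d}} n →
                   (ℤ.+ a) / 1 ℚ.+ (ℤ.+ b) / d ℚ.< (ℤ.+ n) / 1 → a * d + b < n * d
mixed-fraction-< a b (suc d) n lt
  with fromℚᵘ-+-cancel-< (ℚᵘ.mkℚᵘ (ℤ.+ a) 0) (ℚᵘ.mkℚᵘ (ℤ.+ b) d) (ℚᵘ.mkℚᵘ (ℤ.+ n) 0) lt
... | ℚᵘ.*<* lt′ = ℤ.drop‿+<+ (subst₂ ℤ._<_ left right lt′)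
  where
  left : (ℤ.+ a ℤ.* ℤ.+ suc d ℤ.+ ℤ.+ b ℤ.* ℤ.+ 1) ℤ.* ℤ.+ 1 ≡ ℤ.+ (a * suc d + b)
  left = trans (ℤ.*-identityʳ _)
    (cong₂ ℤ._+_ (sym (ℤ.pos-* a (suc d))) (ℤ.*-identityʳ (ℤ.+ b)))
  right : ℤ.+ n ℤ.* ℤ.+ (1 * suc d) ≡ ℤ.+ (n * suc d)
  right = trans (cong (λ m → ℤ.+ n ℤ.* ℤ.+ m) (ℕ.*-identityˡ (suc d))) (sym (ℤ.pos-* n (suc d)))

orderBound-< : ∀ {n k} 3≤k → orderBound k 3≤k ℚ.< (ℤ.+ n) / 1 →
               (k * k + 7 * k + 18) * (k ∸ 2) + 33 < n * (k ∸ 2)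
orderBound-< {n} {k} 3≤k lt = subst (λ q → (q + 7 * k + 18) * (k ∸ 2) + 33 < n * (k ∸ 2))
  (cong (k *_) (ℕ.*-identityʳ k))
  (mixed-fraction-< (k ℕ.^ 2 + 7 * k + 18) 33 (k ∸ 2) {{3≤k⇒k∸2≢0 3≤k}} n lt)

order-large : ∀ {n} e → (7 + e ≡ 7 → n ≥ 286) → (7 + e ≡ 8 → n ≥ 207) → (7 + e ≡ 9 → n ≥ 190) →
              (7 + e ≥ 10 → ((7 + e) * (7 + e) + 7 * (7 + e) + 18) * (5 + e) + 33 < n * (5 + e)) → Case7.Large e n
order-large 0 h _ _ _ = Case7.large-7 (h refl)
order-large 1 _ h _ _ = Case7.large-8 (h refl)
order-large 2 _ _ h _ = Case7.large-9 (h refl)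
order-large (suc (suc (suc e))) _ _ _ h = Case7.large-10 (h (ℕ.m≤m+n 10 e))

module _ {n} (G : Graph n) where

  σ₄-integer-bound : ∀ i d → σ₄ G ≥∞ (i / suc d) → σ₄-Holds G (λ s → i ℤ.≤ ℤ.+ (s * suc d))
  σ₄-integer-bound i d σ₄≥ xs u len ind =
    /-≤-integer i d (totalDegree G xs) (σ₄-lower-bound G {i / suc d} σ₄≥ xs u len ind)

  case-3-bound : σ₄ G ≥∞ ((ℤ.+ 2 ℤ.* ℤ.+ n ℤ.- ℤ.+ 7) / 1) → σ₄-Holds G (λ s → 2 * n ≤ s + 7)
  case-3-bound σ₄≥ xs u len ind = subst (λ s → 2 * n ≤ s + 7) (ℕ.*-identityʳ (totalDegree G xs))
    (ℤ.drop‿+≤+ (subst (λ i → i ℤ.≤ ℤ.+ (totalDegree G xs * 1 + 7)) (sym (ℤ.pos-* 2 n))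
      (minus-≤ {ℤ.+ 2 ℤ.* ℤ.+ n} 7 (σ₄-integer-bound (ℤ.+ 2 ℤ.* ℤ.+ n ℤ.- ℤ.+ 7) 0 σ₄≥ xs u len ind))))

  case-4-bound : σ₄ G ≥∞ (ℤ.+ n / 1) → σ₄-Holds G (n ≤_)
  case-4-bound σ₄≥ xs u len ind = subst (n ≤_) (ℕ.*-identityʳ (totalDegree G xs))
    (ℤ.drop‿+≤+ (σ₄-integer-bound (ℤ.+ n) 0 σ₄≥ xs u len ind))

  case-5-bound : σ₄ G ≥∞ ((ℤ.+ n ℤ.- ℤ.+ 1) / 1) → σ₄-Holds G (λ s → n ≤ s + 1)
  case-5-bound σ₄≥ xs u len ind = subst (λ s → n ≤ s + 1) (ℕ.*-identityʳ (totalDegree G xs))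
    (ℤ.drop‿+≤+ (minus-≤ {ℤ.+ n} 1 (σ₄-integer-bound (ℤ.+ n ℤ.- ℤ.+ 1) 0 σ₄≥ xs u len ind)))

  case-6-bound : σ₄ G ≥∞ (ℤ.+ (n + 5) / 2) → σ₄-Holds G (λ s → n + 5 ≤ 2 * s)
  case-6-bound σ₄≥ xs u len ind = subst (n + 5 ≤_) (ℕ.*-comm (totalDegree G xs) 2)
    (ℤ.drop‿+≤+ (σ₄-integer-bound (ℤ.+ (n + 5)) 1 σ₄≥ xs u len ind))

  case-7-bound : ∀ e → σ₄ G ≥∞ ((ℤ.+ 4 ℤ.* ℤ.+ n ℤ.- ℤ.+ 4 ℤ.* ℤ.+ (7 + e) ℤ.- ℤ.+ 7) / (9 + e)) →
                 σ₄-Holds G (Case7.Bound e n)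
  case-7-bound e σ₄≥ xs u len ind = ≤-trans
    (ℤ.drop‿+≤+ (subst (λ i → i ℤ.≤ ℤ.+ (totalDegree G xs * (9 + e) + 7 + 4 * (7 + e))) (sym (ℤ.pos-* 4 n))
      (minus-≤ {ℤ.+ 4 ℤ.* ℤ.+ n} (4 * (7 + e))
        (subst (λ i → ℤ.+ 4 ℤ.* ℤ.+ n ℤ.- i ℤ.≤ ℤ.+ (totalDegree G xs * (9 + e) + 7)) (sym (ℤ.pos-* 4 (7 + e)))
          (minus-≤ {ℤ.+ 4 ℤ.* ℤ.+ n ℤ.- ℤ.+ 4 ℤ.* ℤ.+ (7 + e)} 7
            (σ₄-integer-bound (ℤ.+ 4 ℤ.* ℤ.+ n ℤ.- ℤ.+ 4 ℤ.* ℤ.+ (7 + e) ℤ.- ℤ.+ 7) (8 + e) σ₄≥ xs u len ind))))))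
    (≤-reflexive (rearrange e (totalDegree G xs)))
    where
    rearrange : ∀ e s → s * (9 + e) + 7 + 4 * (7 + e) ≡ (9 + e) * s + (35 + 4 * e)
    rearrange = solve-∀

open import Data.Integer using (+_)

theorem4 : ∀ (n : ℕ) (G : Graph n) → Connected G →
    ∀ (k : ℕ) (3≤k : 3 ≤ k) →
    (k ≡ 3 × n ≥ 8 × σ₄ G ≥∞ ((+ 2 ℤ.* + n ℤ.- + 7) / 1))
    ⊎ (k ≡ 4 × n ≥ 9 × σ₄ G ≥∞ (+ n / 1))
    ⊎ (k ≡ 5 × n ≥ 11 × σ₄ G ≥∞ ((+ n ℤ.- + 1) / 1))
    ⊎ (k ≡ 6 × n ≥ 17 × σ₄ G ≥∞ (+ (n + 5) / 2))
    ⊎ (k ≥ 7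
    × σ₄ G ≥∞ ((+ 4 ℤ.* + n ℤ.- + 4 ℤ.* + k ℤ.- + 7) / (2 + k))
    × (k ≡ 7 → n ≥ 286)
    × (k ≡ 8 → n ≥ 207)
    × (k ≡ 9 → n ≥ 190)
    × (k ≥ 10 → (+ n / 1) ℚ.> orderBound k 3≤k)) →
    ∃[ c ] IsCfc G c × c ≤ k
theorem4 n G connected _ _ (inj₁ (refl , n≥8 , σ₄≥)) =
  few-unmatcheds⇒cfc≤ G connected (≤-trans (s≤s z≤n) n≥8) 1
    λ tree _ → few-3 G tree n≥8 (case-3-bound G σ₄≥)
theorem4 n G connected _ _ (inj₂ (inj₁ (refl , n≥9 , σ₄≥))) =
  few-unmatcheds⇒cfc≤ G connected (≤-trans (s≤s z≤n) n≥9) 2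
    λ tree _ → few-4 G tree (case-4-bound G σ₄≥)
theorem4 n G connected _ _ (inj₂ (inj₂ (inj₁ (refl , n≥11 , σ₄≥)))) =
  few-unmatcheds⇒cfc≤ G connected (≤-trans (s≤s z≤n) n≥11) 3
    λ tree _ → few-5 G tree n≥11 (case-5-bound G σ₄≥)
theorem4 n G connected _ _ (inj₂ (inj₂ (inj₂ (inj₁ (refl , n≥17 , σ₄≥))))) =
  few-unmatcheds⇒cfc≤ G connected (≤-trans (s≤s z≤n) n≥17) 4
    λ tree r-max → few-6 G tree r-max (case-6-bound G σ₄≥)
theorem4 n G connected k 3≤k (inj₂ (inj₂ (inj₂ (inj₂ (k≥7 , σ₄≥ , k≡7 , k≡8 , k≡9 , k≥10))))) with ℕ.m≤n⇒∃[o]m+o≡n k≥7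
... | e , refl = few-unmatcheds⇒cfc≤ G connected (≤-trans (s≤s z≤n) (Case7.Large.for-many large)) (5 + e)
      λ tree r-max → few-7 G tree large r-max (case-7-bound G e σ₄≥)
  where
  large : Case7.Large e n
  large = order-large e k≡7 k≡8 k≡9 (λ k≥10′ → orderBound-< {n} {7 + e} 3≤k (k≥10 k≥10′))
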